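{- Let $\alpha=[0;a_1,a_2,\ldots]\in\mathbf{Bad}$ be such that its continued fraction expansion begins in infinitely many palindromes, i.e. there are infinitely many $n$ such that the word $a_1a_2\ldots a_n$ is a palindrome. Let $\beta$ be any real number equal to $\alpha$ up to a rational homography. Then $\inf_{q\ge1}q\cdot\Vert q\alpha\Vert\cdot\Vert q\beta\Vert=0$ and, moreover, $$\liminf_{q\to+\infty}q^2\cdot\Vert q\alpha\Vert\cdot\Vert q\beta\Vert<+\infty.$$
   Context: For a real number $y$, $\Vert y\Vert$ denotes the distance from $y$ to the nearest integer. $\mathbf{Bad}=\{\alpha\in\mathbb{R} : \inf_{q\ge1} q\Vert q\alpha\Vert>0\}$ (equivalently, real numbers with bounded partial quotients). A finite word $w_1\ldots w_n$ is a palindrome if $w_i=w_{n+1-i}$ for all $i$. A real number $\beta$ is equal to $\alpha$ up to a rational homography if $\beta=(a\alpha+b)/(c\alpha+d)$ for some integers $a,b,c,d$ with $ad-bc\neq0$. -}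

module Defs where

open import Data.Nat.Base as ℕ using (ℕ; zero; suc)
import Data.Nat.Properties as ℕ
open import Data.Integer.Base as ℤ using (ℤ; +_; 0ℤ)
import Data.Integer.Properties as ℤ
import Data.Integer.DivMod as ℤ
open import Data.Rational.Base as ℚ using (ℚ; 0ℚ; 1ℚ; ½; mkℚ; ↥_; ↧_; *≤*; *<*)
import Data.Rational.Properties as ℚ
open import Data.Rational.Solver using (module +-*-Solver)
open import Data.Nat.Coprimality using (1-coprimeTo) renaming (sym to coprime-sym)
open import Data.Fin.Base using (toℕ; opposite)
open import Data.Vec.Functional using (Vector)
open import Data.Product.Base using (Σ-syntax; ∃-syntax; _×_; _,_; proj₁; proj₂)
open import Data.Sum.Base using (_⊎_; inj₁; inj₂)
open import Function.Base using (_∘_; _$_)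
open import Relation.Nullary.Decidable.Core using (yes; no)
open import Relation.Nullary.Negation.Core using (contradiction)
open import Relation.Binary.PropositionalEquality

Eventually : (ℕ → Set) → Set
Eventually P = ∃[ N ] ∀ n → N ℕ.≤ n → P n

InfinitelyOften : (ℕ → Set) → Set
InfinitelyOften P = ∀ N → ∃[ n ] N ℕ.≤ n × P n

ℤ⇒ℚ : ℤ → ℚ
ℤ⇒ℚ i = i ℚ./ 1

-- Total reciprocal, so that the reciprocal of a real apart from 0 can be taken
-- termwise: finitely many terms of its sequence may vanish.
inv : ℚ → ℚ
inv p with p ℚ.≟ 0ℚ
... | yes _   = 0ℚ
... | no  p≢0 = ℚ.1/_ p {{ℚ.≢-nonZero p≢0}}

-- The distance to the nearest integer: see distℤ-least and distℤ-attained.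
distℤ : ℚ → ℚ
distℤ p = ℚ.∣ p ℚ.- ℤ⇒ℚ (ℚ.floor p) ∣ ℚ.⊓ ℚ.∣ p ℚ.- ℤ⇒ℚ (ℚ.ceiling p) ∣

inv-inverse : ∀ p → p ≢ 0ℚ → inv p ℚ.* p ≡ 1ℚ
inv-inverse p p≢0 with p ℚ.≟ 0ℚ
... | yes p≡0 = contradiction p≡0 p≢0
... | no  p≢0 = ℚ.*-inverseˡ p {{ℚ.≢-nonZero p≢0}}

ℤ⇒ℚ-mkℚ : ∀ i → ℤ⇒ℚ i ≡ mkℚ i 0 (coprime-sym (1-coprimeTo ℤ.∣ i ∣))
ℤ⇒ℚ-mkℚ i = ℚ.↥p/↧p≡p (mkℚ i 0 (coprime-sym (1-coprimeTo ℤ.∣ i ∣)))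

ℤ⇒ℚ-mono : ∀ {i j} → i ℤ.≤ j → ℤ⇒ℚ i ℚ.≤ ℤ⇒ℚ j
ℤ⇒ℚ-mono {i} {j} i≤j rewrite ℤ⇒ℚ-mkℚ i | ℤ⇒ℚ-mkℚ j =
  *≤* (ℤ.*-monoʳ-≤-nonNeg (+ 1) i≤j)

neg-involutive : ∀ p → ℚ.- (ℚ.- p) ≡ p
neg-involutive = solve 1 (λ p → :- (:- p) := p) refl
  where open +-*-Solver

ℤ⇒ℚ-neg : ∀ i → ℤ⇒ℚ (ℤ.- i) ≡ ℚ.- ℤ⇒ℚ i
ℤ⇒ℚ-neg (+ zero)     = refl
ℤ⇒ℚ-neg (+ suc n)    = refl
ℤ⇒ℚ-neg (ℤ.-[1+ n ]) = sym (neg-involutive (ℤ⇒ℚ (+ suc n)))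

floor-≤ : ∀ p → ℤ⇒ℚ (ℚ.floor p) ℚ.≤ p
floor-≤ p@record{} rewrite ℤ⇒ℚ-mkℚ (ℚ.floor p) = *≤* $
  subst (ℚ.floor p ℤ.* ↧ p ℤ.≤_) (sym (ℤ.*-identityʳ (↥ p))) (ℤ.[n/d]*d≤n (↥ p) (↧ p))

floor-greatest : ∀ p i → ℤ⇒ℚ i ℚ.≤ p → i ℤ.≤ ℚ.floor p
floor-greatest p@(mkℚ n d-1 _) i i≤p rewrite ℤ⇒ℚ-mkℚ i with i≤p
... | *≤* h = subst₂ ℤ._≤_ (ℤ.pred-suc i) (ℤ.pred-suc (ℚ.floor p)) (ℤ.pred-mono (ℤ.i<j⇒suc[i]≤j i<))
  where
  i*d≤n : i ℤ.* + suc d-1 ℤ.≤ n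
  i*d≤n = subst (i ℤ.* + suc d-1 ℤ.≤_) (ℤ.*-identityʳ n) h
  n<s : n ℤ.< ℤ.suc (ℚ.floor p) ℤ.* + suc d-1
  n<s = subst (λ k → n ℤ.< ℤ.suc k ℤ.* + suc d-1) (sym (ℤ.div-pos-is-/ℕ n (suc d-1)))
              (ℤ.n<s[n/ℕd]*d n (suc d-1))
  i< : i ℤ.< ℤ.suc (ℚ.floor p)
  i< = ℤ.*-cancelʳ-<-nonNeg (+ suc d-1) (ℤ.≤-<-trans i*d≤n n<s)

≤-ceiling : ∀ p → p ℚ.≤ ℤ⇒ℚ (ℚ.ceiling p)
≤-ceiling p@record{} = subst₂ ℚ._≤_ (neg-involutive p) (sym (ℤ⇒ℚ-neg (ℚ.floor (ℚ.- p))))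
  (ℚ.neg-antimono-≤ (floor-≤ (ℚ.- p)))

ceiling-least : ∀ p i → p ℚ.≤ ℤ⇒ℚ i → ℚ.ceiling p ℤ.≤ i
ceiling-least p@record{} i p≤i = subst (ℚ.ceiling p ℤ.≤_) (ℤ.neg-involutive i) $
  ℤ.neg-mono-≤ $ floor-greatest (ℚ.- p) (ℤ.- i) $
  subst (ℚ._≤ ℚ.- p) (sym (ℤ⇒ℚ-neg i)) (ℚ.neg-antimono-≤ p≤i)

∣p-q∣≡∣q-p∣ : ∀ p q → ℚ.∣ p ℚ.- q ∣ ≡ ℚ.∣ q ℚ.- p ∣
∣p-q∣≡∣q-p∣ p q = trans (sym (ℚ.∣-p∣≡∣p∣ (p ℚ.- q))) (cong ℚ.∣_∣ (eq p q))
  where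
  open +-*-Solver
  eq : ∀ p q → ℚ.- (p ℚ.- q) ≡ q ℚ.- p
  eq = solve 2 (λ p q → :- (p :- q) := q :- p) refl

p≤q⇒∣q-p∣≡q-p : ∀ {p q} → p ℚ.≤ q → ℚ.∣ q ℚ.- p ∣ ≡ q ℚ.- p
p≤q⇒∣q-p∣≡q-p {p} {q} p≤q = ℚ.0≤p⇒∣p∣≡p $
  subst (ℚ._≤ q ℚ.- p) (ℚ.+-inverseʳ p) (ℚ.+-monoˡ-≤ (ℚ.- p) p≤q)

∣-∣-nested : ∀ {p q r} → p ℚ.≤ q → q ℚ.≤ r →
             ℚ.∣ r ℚ.- q ∣ ℚ.≤ ℚ.∣ r ℚ.- p ∣ × ℚ.∣ p ℚ.- q ∣ ℚ.≤ ℚ.∣ p ℚ.- r ∣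
∣-∣-nested {p} {q} {r} p≤q q≤r =
    subst₂ ℚ._≤_ (sym (p≤q⇒∣q-p∣≡q-p q≤r)) (sym (p≤q⇒∣q-p∣≡q-p p≤r))
      (ℚ.+-monoʳ-≤ r (ℚ.neg-antimono-≤ p≤q))
  , subst₂ ℚ._≤_ (trans (sym (p≤q⇒∣q-p∣≡q-p p≤q)) (∣p-q∣≡∣q-p∣ q p))
                 (trans (sym (p≤q⇒∣q-p∣≡q-p p≤r)) (∣p-q∣≡∣q-p∣ r p))
      (ℚ.+-monoˡ-≤ (ℚ.- p) q≤r)
  where p≤r = ℚ.≤-trans p≤q q≤r

distℤ-least : ∀ p i → distℤ p ℚ.≤ ℚ.∣ p ℚ.- ℤ⇒ℚ i ∣
distℤ-least p i with ℚ.≤-total (ℤ⇒ℚ i) p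
... | inj₁ i≤p = ℚ.≤-trans (ℚ.p⊓q≤p _ _)
  (proj₁ (∣-∣-nested (ℤ⇒ℚ-mono (floor-greatest p i i≤p)) (floor-≤ p)))
... | inj₂ p≤i = ℚ.≤-trans (ℚ.p⊓q≤q ℚ.∣ p ℚ.- ℤ⇒ℚ (ℚ.floor p) ∣ _)
  (proj₂ (∣-∣-nested (≤-ceiling p) (ℤ⇒ℚ-mono (ceiling-least p i p≤i))))

distℤ-attained : ∀ p → ∃[ i ] distℤ p ≡ ℚ.∣ p ℚ.- ℤ⇒ℚ i ∣
distℤ-attained p with ℚ.⊓-sel ℚ.∣ p ℚ.- ℤ⇒ℚ (ℚ.floor p) ∣ ℚ.∣ p ℚ.- ℤ⇒ℚ (ℚ.ceiling p) ∣
... | inj₁ eq = ℚ.floor p   , eq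
... | inj₂ eq = ℚ.ceiling p , eq

p≤r+q⇒p-q≤r : ∀ {p q r} → p ℚ.≤ r ℚ.+ q → p ℚ.- q ℚ.≤ r
p≤r+q⇒p-q≤r {p} {q} {r} h = subst (p ℚ.- q ℚ.≤_) (eq q r) (ℚ.+-monoˡ-≤ (ℚ.- q) h)
  where
  open +-*-Solver
  eq : ∀ q r → r ℚ.+ q ℚ.- q ≡ r
  eq = solve 2 (λ q r → r :+ q :- q := r) refl

∣p-q∣≤r : ∀ {p q r} → p ℚ.≤ r ℚ.+ q → q ℚ.≤ r ℚ.+ p → ℚ.∣ p ℚ.- q ∣ ℚ.≤ r
∣p-q∣≤r {p} {q} {r} h₁ h₂ with ℚ.≤-total q p
... | inj₁ q≤p = subst (ℚ._≤ r) (sym (p≤q⇒∣q-p∣≡q-p q≤p)) (p≤r+q⇒p-q≤r h₁)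
... | inj₂ p≤q = subst (ℚ._≤ r) (trans (sym (p≤q⇒∣q-p∣≡q-p p≤q)) (∣p-q∣≡∣q-p∣ q p))
                   (p≤r+q⇒p-q≤r h₂)

triangle : ∀ p q r → ℚ.∣ p ℚ.- r ∣ ℚ.≤ ℚ.∣ p ℚ.- q ∣ ℚ.+ ℚ.∣ q ℚ.- r ∣
triangle p q r = subst (ℚ._≤ ℚ.∣ p ℚ.- q ∣ ℚ.+ ℚ.∣ q ℚ.- r ∣) (cong ℚ.∣_∣ (eq p q r))
  (ℚ.∣p+q∣≤∣p∣+∣q∣ (p ℚ.- q) (q ℚ.- r))
  where
  open +-*-Solver
  eq : ∀ p q r → (p ℚ.- q) ℚ.+ (q ℚ.- r) ≡ p ℚ.- r
  eq = solve 3 (λ p q r → (p :- q) :+ (q :- r) := p :- r) refl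

distℤ-1-Lipschitz : ∀ p q → ℚ.∣ distℤ p ℚ.- distℤ q ∣ ℚ.≤ ℚ.∣ p ℚ.- q ∣
distℤ-1-Lipschitz p q = ∣p-q∣≤r (half p q)
  (subst (λ d → distℤ q ℚ.≤ d ℚ.+ distℤ p) (∣p-q∣≡∣q-p∣ q p) (half q p))
  where
  half : ∀ p q → distℤ p ℚ.≤ ℚ.∣ p ℚ.- q ∣ ℚ.+ distℤ q
  half p q with distℤ-attained q
  ... | i , eq = subst (λ d → distℤ p ℚ.≤ ℚ.∣ p ℚ.- q ∣ ℚ.+ d) (sym eq)
    (ℚ.≤-trans (distℤ-least p i) (triangle p q (ℤ⇒ℚ i)))

∣-∣-1-Lipschitz : ∀ p q → ℚ.∣ ℚ.∣ p ∣ ℚ.- ℚ.∣ q ∣ ∣ ℚ.≤ ℚ.∣ p ℚ.- q ∣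
∣-∣-1-Lipschitz p q = ∣p-q∣≤r (half p q)
  (subst (λ d → ℚ.∣ q ∣ ℚ.≤ d ℚ.+ ℚ.∣ p ∣) (∣p-q∣≡∣q-p∣ q p) (half q p))
  where
  open +-*-Solver
  eq : ∀ p q → p ℚ.- q ℚ.+ q ≡ p
  eq = solve 2 (λ p q → p :- q :+ q := p) refl
  half : ∀ p q → ℚ.∣ p ∣ ℚ.≤ ℚ.∣ p ℚ.- q ∣ ℚ.+ ℚ.∣ q ∣
  half p q = subst (λ t → ℚ.∣ t ∣ ℚ.≤ ℚ.∣ p ℚ.- q ∣ ℚ.+ ℚ.∣ q ∣) (eq p q)
    (ℚ.∣p+q∣≤∣p∣+∣q∣ (p ℚ.- q) q)

neg-1-Lipschitz : ∀ p q → ℚ.∣ ℚ.- p ℚ.- ℚ.- q ∣ ℚ.≤ ℚ.∣ p ℚ.- q ∣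
neg-1-Lipschitz p q = ℚ.≤-reflexive (trans (cong ℚ.∣_∣ (eq p q)) (∣p-q∣≡∣q-p∣ q p))
  where
  open +-*-Solver
  eq : ∀ p q → ℚ.- p ℚ.- ℚ.- q ≡ q ℚ.- p
  eq = solve 2 (λ p q → :- p :- :- q := q :- p) refl

pos*pos : ∀ {p q} → 0ℚ ℚ.< p → 0ℚ ℚ.< q → 0ℚ ℚ.< p ℚ.* q
pos*pos {p} {q} p>0 q>0 = ℚ.positive⁻¹ (p ℚ.* q)
  {{ℚ.pos*pos⇒pos p {{ℚ.positive p>0}} q {{ℚ.positive q>0}}}}

0<½ : 0ℚ ℚ.< ½
0<½ = ℚ.positive⁻¹ ½

½ε+½ε≡ε : ∀ ε → ½ ℚ.* ε ℚ.+ ½ ℚ.* ε ≡ ε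
½ε+½ε≡ε ε = trans (sym (ℚ.*-distribʳ-+ ε ½ ½)) (ℚ.*-identityˡ ε)

quotient : ∀ {a ε} → 0ℚ ℚ.< a → 0ℚ ℚ.< ε → ∃[ η ] 0ℚ ℚ.< η × a ℚ.* η ≡ ε
quotient {a} {ε} a>0 ε>0 = 1/a ℚ.* ε , pos*pos 1/a>0 ε>0 , (begin
  a ℚ.* (1/a ℚ.* ε)   ≡⟨ ℚ.*-assoc a 1/a ε ⟨
  a ℚ.* 1/a ℚ.* ε     ≡⟨ cong (ℚ._* ε) (ℚ.*-inverseʳ a {{a≢0}}) ⟩
  1ℚ ℚ.* ε            ≡⟨ ℚ.*-identityˡ ε ⟩
  ε                   ∎)
  where
  open ≡-Reasoning
  a≢0   = ℚ.pos⇒nonZero a {{ℚ.positive a>0}}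
  1/a   = ℚ.1/_ a {{a≢0}}
  1/a>0 = ℚ.positive⁻¹ 1/a {{ℚ.1/pos⇒pos a {{ℚ.positive a>0}}}}

*-mono-≤ : ∀ {p p′ q q′} → 0ℚ ℚ.≤ p → 0ℚ ℚ.≤ q →
           p ℚ.≤ p′ → q ℚ.≤ q′ → p ℚ.* q ℚ.≤ p′ ℚ.* q′
*-mono-≤ {p} {p′} {q} {q′} p≥0 q≥0 p≤p′ q≤q′ = ℚ.≤-trans
  (ℚ.*-monoˡ-≤-nonNeg p {{ℚ.nonNegative p≥0}} q≤q′)
  (ℚ.*-monoʳ-≤-nonNeg q′ {{ℚ.nonNegative (ℚ.≤-trans q≥0 q≤q′)}} p≤p′)

inv-close : ∀ {δ ε p q} → 0ℚ ℚ.< δ → 0ℚ ℚ.< ε → δ ℚ.≤ ℚ.∣ p ∣ → δ ℚ.≤ ℚ.∣ q ∣ →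
            ℚ.∣ p ℚ.- q ∣ ℚ.≤ ε ℚ.* (δ ℚ.* δ) → ℚ.∣ inv p ℚ.- inv q ∣ ℚ.≤ ε
inv-close {δ} {ε} {p} {q} δ>0 ε>0 δ≤p δ≤q p-q =
  ℚ.*-cancelʳ-≤-pos (ℚ.∣ p ∣ ℚ.* ℚ.∣ q ∣) {{ℚ.positive ∣p∣∣q∣>0}} (begin
  ℚ.∣ inv p ℚ.- inv q ∣ ℚ.* (ℚ.∣ p ∣ ℚ.* ℚ.∣ q ∣)
    ≡⟨ cong (ℚ.∣ inv p ℚ.- inv q ∣ ℚ.*_) (ℚ.∣p*q∣≡∣p∣*∣q∣ p q) ⟨
  ℚ.∣ inv p ℚ.- inv q ∣ ℚ.* ℚ.∣ p ℚ.* q ∣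
    ≡⟨ ℚ.∣p*q∣≡∣p∣*∣q∣ (inv p ℚ.- inv q) (p ℚ.* q) ⟨
  ℚ.∣ (inv p ℚ.- inv q) ℚ.* (p ℚ.* q) ∣
    ≡⟨ cong ℚ.∣_∣ (eq (inv p) (inv q) p q) ⟩
  ℚ.∣ (inv p ℚ.* p) ℚ.* q ℚ.- (inv q ℚ.* q) ℚ.* p ∣
    ≡⟨ cong₂ (λ s t → ℚ.∣ s ℚ.* q ℚ.- t ℚ.* p ∣)
         (inv-inverse p (nonzero δ≤p)) (inv-inverse q (nonzero δ≤q)) ⟩
  ℚ.∣ 1ℚ ℚ.* q ℚ.- 1ℚ ℚ.* p ∣
    ≡⟨ cong₂ (λ s t → ℚ.∣ s ℚ.- t ∣) (ℚ.*-identityˡ q) (ℚ.*-identityˡ p) ⟩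
  ℚ.∣ q ℚ.- p ∣
    ≡⟨ ∣p-q∣≡∣q-p∣ q p ⟩
  ℚ.∣ p ℚ.- q ∣
    ≤⟨ p-q ⟩
  ε ℚ.* (δ ℚ.* δ)
    ≤⟨ ℚ.*-monoˡ-≤-nonNeg ε {{ℚ.nonNegative (ℚ.<⇒≤ ε>0)}}
         (*-mono-≤ (ℚ.<⇒≤ δ>0) (ℚ.<⇒≤ δ>0) δ≤p δ≤q) ⟩
  ε ℚ.* (ℚ.∣ p ∣ ℚ.* ℚ.∣ q ∣) ∎)
  where
  open ℚ.≤-Reasoning
  ∣p∣∣q∣>0 = pos*pos (ℚ.<-≤-trans δ>0 δ≤p) (ℚ.<-≤-trans δ>0 δ≤q)
  nonzero : ∀ {r} → δ ℚ.≤ ℚ.∣ r ∣ → r ≢ 0ℚ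
  nonzero δ≤r refl = ℚ.<-irrefl refl (ℚ.<-≤-trans δ>0 δ≤r)
  eq : ∀ i j p q → (i ℚ.- j) ℚ.* (p ℚ.* q) ≡ (i ℚ.* p) ℚ.* q ℚ.- (j ℚ.* q) ℚ.* p
  eq = solve 4 (λ i j p q → (i :- j) :* (p :* q) := (i :* p) :* q :- (j :* q) :* p) refl
    where open +-*-Solver

Cauchy : (ℕ → ℚ) → Set
Cauchy x = ∀ ε → 0ℚ ℚ.< ε →
  ∃[ N ] ∀ m n → N ℕ.≤ m → N ℕ.≤ n → ℚ.∣ x m ℚ.- x n ∣ ℚ.≤ ε

record ℝ : Set where
  constructor mkℝ
  field
    seq    : ℕ → ℚ
    cauchy : Cauchy seq
open ℝ public

infix 4 _≈_ _≤_ _<_ _#_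

_≈_ _≤_ _<_ _#_ : ℝ → ℝ → Set
x ≈ y = ∀ ε → 0ℚ ℚ.< ε → Eventually λ n → ℚ.∣ seq x n ℚ.- seq y n ∣ ℚ.≤ ε
x ≤ y = ∀ ε → 0ℚ ℚ.< ε → Eventually λ n → seq x n ℚ.≤ seq y n ℚ.+ ε
x < y = ∃[ ε ] 0ℚ ℚ.< ε × Eventually λ n → seq x n ℚ.+ ε ℚ.≤ seq y n
x # y = x < y ⊎ y < x

fromℚ : ℚ → ℝ
fromℚ p = mkℝ (λ _ → p) λ ε ε>0 → 0 , λ _ _ _ _ →
  subst (ℚ._≤ ε) (sym (cong ℚ.∣_∣ (ℚ.+-inverseʳ p))) (ℚ.<⇒≤ ε>0)

fromℤ : ℤ → ℝ
fromℤ i = fromℚ (ℤ⇒ℚ i)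

fromℕ : ℕ → ℝ
fromℕ n = fromℤ (+ n)

0ℝ : ℝ
0ℝ = fromℚ 0ℚ

extend : (f : ℚ → ℚ) → (∀ p q → ℚ.∣ f p ℚ.- f q ∣ ℚ.≤ ℚ.∣ p ℚ.- q ∣) → ℝ → ℝ
extend f lip (mkℝ x cx) = mkℝ (f ∘ x) λ ε ε>0 → let (N , h) = cx ε ε>0 in
  N , λ m n N≤m N≤n → ℚ.≤-trans (lip (x m) (x n)) (h m n N≤m N≤n)

infix  8 -_
infixl 7 _*_
infixl 6 _+_ _-_

-_ ∣_∣ ‖_‖ : ℝ → ℝ
-_  = extend ℚ.-_   neg-1-Lipschitz
∣_∣ = extend ℚ.∣_∣  ∣-∣-1-Lipschitz
‖_‖ = extend distℤ  distℤ-1-Lipschitz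

_+_ : ℝ → ℝ → ℝ
mkℝ x cx + mkℝ y cy = mkℝ (λ n → x n ℚ.+ y n) λ ε ε>0 →
  let (M , f) = cx (½ ℚ.* ε) (pos*pos 0<½ ε>0)
      (N , g) = cy (½ ℚ.* ε) (pos*pos 0<½ ε>0)
  in M ℕ.⊔ N , λ m n hm hn → begin
    ℚ.∣ x m ℚ.+ y m ℚ.- (x n ℚ.+ y n) ∣
      ≡⟨ cong ℚ.∣_∣ (eq (x m) (y m) (x n) (y n)) ⟩
    ℚ.∣ (x m ℚ.- x n) ℚ.+ (y m ℚ.- y n) ∣
      ≤⟨ ℚ.∣p+q∣≤∣p∣+∣q∣ (x m ℚ.- x n) (y m ℚ.- y n) ⟩
    ℚ.∣ x m ℚ.- x n ∣ ℚ.+ ℚ.∣ y m ℚ.- y n ∣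
      ≤⟨ ℚ.+-mono-≤ (f m n (ℕ.m⊔n≤o⇒m≤o M N hm) (ℕ.m⊔n≤o⇒m≤o M N hn))
                    (g m n (ℕ.m⊔n≤o⇒n≤o M N hm) (ℕ.m⊔n≤o⇒n≤o M N hn)) ⟩
    ½ ℚ.* ε ℚ.+ ½ ℚ.* ε
      ≡⟨ ½ε+½ε≡ε ε ⟩
    ε ∎
  where
  open ℚ.≤-Reasoning
  eq : ∀ a b c d → a ℚ.+ b ℚ.- (c ℚ.+ d) ≡ (a ℚ.- c) ℚ.+ (b ℚ.- d)
  eq = solve 4 (λ a b c d → a :+ b :- (c :+ d) := (a :- c) :+ (b :- d)) refl
    where open +-*-Solver

_-_ : ℝ → ℝ → ℝ
x - y = x + (- y)

eventually-bounded : ∀ x → ∃[ A ] 0ℚ ℚ.< A × Eventually λ n → ℚ.∣ seq x n ∣ ℚ.≤ A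
eventually-bounded (mkℝ x cx) =
  let (N , h) = cx 1ℚ (ℚ.positive⁻¹ 1ℚ)
  in 1ℚ ℚ.+ ℚ.∣ x N ∣
   , ℚ.positive⁻¹ _ {{ℚ.pos+nonNeg⇒pos 1ℚ ℚ.∣ x N ∣ {{ℚ.∣-∣-nonNeg (x N)}}}}
   , N , λ n N≤n → begin
     ℚ.∣ x n ∣                           ≡⟨ cong ℚ.∣_∣ (eq (x n) (x N)) ⟩
     ℚ.∣ (x n ℚ.- x N) ℚ.+ x N ∣         ≤⟨ ℚ.∣p+q∣≤∣p∣+∣q∣ (x n ℚ.- x N) (x N) ⟩
     ℚ.∣ x n ℚ.- x N ∣ ℚ.+ ℚ.∣ x N ∣     ≤⟨ ℚ.+-monoˡ-≤ ℚ.∣ x N ∣ (h n N N≤n ℕ.≤-refl) ⟩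
     1ℚ ℚ.+ ℚ.∣ x N ∣                    ∎
  where
  open ℚ.≤-Reasoning
  eq : ∀ p q → p ≡ (p ℚ.- q) ℚ.+ q
  eq = solve 2 (λ p q → p := (p :- q) :+ q) refl
    where open +-*-Solver

_*_ : ℝ → ℝ → ℝ
x′@(mkℝ x cx) * y′@(mkℝ y cy) = mkℝ (λ n → x n ℚ.* y n) λ ε ε>0 →
  let (A , A>0 , K , boundx) = eventually-bounded x′
      (B , B>0 , L , boundy) = eventually-bounded y′
      (η , η>0 , Aη≡½ε)      = quotient A>0 (pos*pos 0<½ ε>0)
      (θ , θ>0 , Bθ≡½ε)      = quotient B>0 (pos*pos 0<½ ε>0)
      (M , f)                = cx θ θ>0
      (N , g)                = cy η η>0
  in (K ℕ.⊔ L) ℕ.⊔ (M ℕ.⊔ N) , λ m n hm hn →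
  let KL≤m = ℕ.m⊔n≤o⇒m≤o (K ℕ.⊔ L) (M ℕ.⊔ N) hm
      KL≤n = ℕ.m⊔n≤o⇒m≤o (K ℕ.⊔ L) (M ℕ.⊔ N) hn
      MN≤m = ℕ.m⊔n≤o⇒n≤o (K ℕ.⊔ L) (M ℕ.⊔ N) hm
      MN≤n = ℕ.m⊔n≤o⇒n≤o (K ℕ.⊔ L) (M ℕ.⊔ N) hn
  in begin
    ℚ.∣ x m ℚ.* y m ℚ.- x n ℚ.* y n ∣
      ≡⟨ cong ℚ.∣_∣ (eq (x m) (y m) (x n) (y n)) ⟩
    ℚ.∣ x m ℚ.* (y m ℚ.- y n) ℚ.+ y n ℚ.* (x m ℚ.- x n) ∣
      ≤⟨ ℚ.∣p+q∣≤∣p∣+∣q∣ (x m ℚ.* (y m ℚ.- y n)) (y n ℚ.* (x m ℚ.- x n)) ⟩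
    ℚ.∣ x m ℚ.* (y m ℚ.- y n) ∣ ℚ.+ ℚ.∣ y n ℚ.* (x m ℚ.- x n) ∣
      ≡⟨ cong₂ ℚ._+_ (ℚ.∣p*q∣≡∣p∣*∣q∣ (x m) (y m ℚ.- y n))
                     (ℚ.∣p*q∣≡∣p∣*∣q∣ (y n) (x m ℚ.- x n)) ⟩
    ℚ.∣ x m ∣ ℚ.* ℚ.∣ y m ℚ.- y n ∣ ℚ.+ ℚ.∣ y n ∣ ℚ.* ℚ.∣ x m ℚ.- x n ∣
      ≤⟨ ℚ.+-mono-≤
           (*-mono-≤ (ℚ.0≤∣p∣ (x m)) (ℚ.0≤∣p∣ (y m ℚ.- y n))
             (boundx m (ℕ.m⊔n≤o⇒m≤o K L KL≤m))
             (g m n (ℕ.m⊔n≤o⇒n≤o M N MN≤m) (ℕ.m⊔n≤o⇒n≤o M N MN≤n)))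
           (*-mono-≤ (ℚ.0≤∣p∣ (y n)) (ℚ.0≤∣p∣ (x m ℚ.- x n))
             (boundy n (ℕ.m⊔n≤o⇒n≤o K L KL≤n))
             (f m n (ℕ.m⊔n≤o⇒m≤o M N MN≤m) (ℕ.m⊔n≤o⇒m≤o M N MN≤n))) ⟩
    A ℚ.* η ℚ.+ B ℚ.* θ
      ≡⟨ cong₂ ℚ._+_ Aη≡½ε Bθ≡½ε ⟩
    ½ ℚ.* ε ℚ.+ ½ ℚ.* ε
      ≡⟨ ½ε+½ε≡ε ε ⟩
    ε ∎
  where
  open ℚ.≤-Reasoning
  eq : ∀ a b c d → a ℚ.* b ℚ.- c ℚ.* d ≡ a ℚ.* (b ℚ.- d) ℚ.+ d ℚ.* (a ℚ.- c)
  eq = solve 4 (λ a b c d → a :* b :- c :* d := a :* (b :- d) :+ d :* (a :- c)) refl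
    where open +-*-Solver

#0⇒bounded-away : ∀ x → x # 0ℝ → ∃[ δ ] 0ℚ ℚ.< δ × Eventually λ n → δ ℚ.≤ ℚ.∣ seq x n ∣
#0⇒bounded-away x (inj₁ (δ , δ>0 , N , h)) = δ , δ>0 , N , λ n N≤n →
  subst (δ ℚ.≤_) (ℚ.∣-p∣≡∣p∣ (seq x n)) $
  δ≤∣p∣ (p+δ≤0⇒δ≤-p (seq x n) (h n N≤n))
  where
  δ≤∣p∣ : ∀ {p} → δ ℚ.≤ p → δ ℚ.≤ ℚ.∣ p ∣
  δ≤∣p∣ δ≤p = subst (δ ℚ.≤_) (sym (ℚ.0≤p⇒∣p∣≡p (ℚ.≤-trans (ℚ.<⇒≤ δ>0) δ≤p))) δ≤p
  eq : ∀ p d → p ℚ.+ d ℚ.- p ≡ d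
  eq = solve 2 (λ p d → p :+ d :- p := d) refl
    where open +-*-Solver
  p+δ≤0⇒δ≤-p : ∀ p → p ℚ.+ δ ℚ.≤ 0ℚ → δ ℚ.≤ ℚ.- p
  p+δ≤0⇒δ≤-p p h = subst₂ ℚ._≤_ (eq p δ) (ℚ.+-identityˡ (ℚ.- p)) (ℚ.+-monoˡ-≤ (ℚ.- p) h)
#0⇒bounded-away x (inj₂ (δ , δ>0 , N , h)) = δ , δ>0 , N , λ n N≤n →
  let δ≤x = subst (ℚ._≤ seq x n) (ℚ.+-identityˡ δ) (h n N≤n)
  in subst (δ ℚ.≤_) (sym (ℚ.0≤p⇒∣p∣≡p (ℚ.≤-trans (ℚ.<⇒≤ δ>0) δ≤x))) δ≤x

recip : (x : ℝ) → x # 0ℝ → ℝ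
recip x′@(mkℝ x cx) x#0 = mkℝ (inv ∘ x) λ ε ε>0 →
  let (δ , δ>0 , M , away) = #0⇒bounded-away x′ x#0
      (N , f)              = cx (ε ℚ.* (δ ℚ.* δ)) (pos*pos ε>0 (pos*pos δ>0 δ>0))
  in M ℕ.⊔ N , λ m n hm hn → inv-close δ>0 ε>0
       (away m (ℕ.m⊔n≤o⇒m≤o M N hm)) (away n (ℕ.m⊔n≤o⇒m≤o M N hn))
       (f m n (ℕ.m⊔n≤o⇒n≤o M N hm) (ℕ.m⊔n≤o⇒n≤o M N hn))

infixl 7 _÷_[_]

_÷_[_] : (x y : ℝ) → y # 0ℝ → ℝ
x ÷ y [ y#0 ] = x * recip y y#0

infix 4 _⟶_ inf[q≥1]_≡_

_⟶_ : (ℕ → ℝ) → ℝ → Set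
s ⟶ x = ∀ ε → 0ℝ < ε → Eventually λ n → ∣ s n - x ∣ < ε

inf[q≥1]_≡_ : (ℕ → ℝ) → ℝ → Set
inf[q≥1] f ≡ m = (∀ q → 1 ℕ.≤ q → m ≤ f q)
               × (∀ ε → 0ℝ < ε → ∃[ q ] 1 ℕ.≤ q × f q < m + ε)

-- A positive lower bound, rather than a positive greatest lower bound: the
-- latter need not exist constructively.
inf[q≥1]_>0 : (ℕ → ℝ) → Set
inf[q≥1] f >0 = ∃[ c ] 0ℝ < c × (∀ q → 1 ℕ.≤ q → c ≤ f q)

-- sup_N inf_{q≥N} f(q) < +∞: a single C exceeds every tail infimum, and
-- inf_{q≥N} f(q) < C unfolds to f(q) < C for some q ≥ N.
liminf_<+∞ : (ℕ → ℝ) → Set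
liminf f <+∞ = ∃[ C ] InfinitelyOften λ q → f q < C

Bad : ℝ → Set
Bad α = inf[q≥1] (λ q → fromℕ q * ‖ fromℕ q * α ‖) >0

-- [a₀; a₁, …, aₙ]; when a₁, a₂, … are positive, only nonzero numbers get inverted.
convergent : (ℕ → ℕ) → ℕ → ℚ
convergent a zero    = ℤ⇒ℚ (+ a 0)
convergent a (suc n) = ℤ⇒ℚ (+ a 0) ℚ.+ inv (convergent (a ∘ suc) n)

-- a is indexed so that α = [a₀; a₁, a₂, …] with a₀ = 0.
record ContinuedFraction (α : ℝ) (a : ℕ → ℕ) : Set where
  field
    a₀≡0     : a 0 ≡ 0
    positive : ∀ i → 1 ℕ.≤ i → 1 ℕ.≤ a i
    limit    : (fromℚ ∘ convergent a) ⟶ α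

Palindrome : ∀ {n} → Vector ℕ n → Set
Palindrome w = ∀ i → w i ≡ w (opposite i)

-- Fin is 0-based, the word is a₁ … aₙ.
word : (ℕ → ℕ) → (n : ℕ) → Vector ℕ n
word a n i = a (suc (toℕ i))

RationalHomography : ℝ → ℝ → Set
RationalHomography α β = ∃[ a ] ∃[ b ] ∃[ c ] ∃[ d ]
  (a ℤ.* d ℤ.- b ℤ.* c ≢ 0ℤ) ×
  Σ[ cα+d#0 ∈ (fromℤ c * α + fromℤ d) # 0ℝ ]
    β ≈ (fromℤ a * α + fromℤ b) ÷ (fromℤ c * α + fromℤ d) [ cα+d#0 ]

{-# OPTIONS --safe #-}

-- Let qₙ, pₙ be the continuants of α. When a₁ … aₙ is a palindrome, the matrix
-- (qₙ qₙ₋₁ ; pₙ pₙ₋₁) is symmetric, so that q = qₙ, p = pₙ = qₙ₋₁ and r = pₙ₋₁ satisfy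
-- q α ≈ p and p α ≈ r, both with error O(1/q). If β = (a α + b)/(c α + d), then
-- Q = c p + d q ≈ (c α + d) q has size of order q, while Q α ≈ c r + d p and
-- Q β ≈ a p + b q, again with error O(1/q); hence Q² ‖Q α‖ ‖Q β‖ is bounded.

module Submission where

open import Defs
open import Data.Nat.Base as ℕ using (ℕ; zero; suc)
import Data.Nat.Properties as ℕ
import Data.Nat.Solver as ℕ
open import Data.Integer.Base as ℤ using (ℤ; +_; -[1+_])
import Data.Integer.Properties as ℤ
open import Data.Rational.Base as ℚ using (ℚ; 0ℚ; 1ℚ; ½)
import Data.Rational.Properties as ℚ
open import Data.Rational.Solver using (module +-*-Solver)
open import Data.Fin.Base using (toℕ; fromℕ<; opposite)
open import Data.Fin.Properties using (toℕ-fromℕ<; opposite-prop)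
open import Data.Product.Base using (∃-syntax; _×_; _,_; proj₁; proj₂)
open import Data.Sum.Base using (inj₁; inj₂)
open import Function.Base using (_∘_)
open import Relation.Binary.PropositionalEquality
open import Relation.Nullary.Decidable.Core using (yes; no)

-- Continuant matrices and their symmetry for palindromes.

record Matrix : Set where
  constructor matrix
  field
    e₁₁ e₁₂ e₂₁ e₂₂ : ℕ
open Matrix

transpose : Matrix → Matrix
transpose (matrix a b c d) = matrix a c b d

-- Left and right multiplication by (x 1 ; 1 0).
cons : ℕ → Matrix → Matrix
cons x (matrix a b c d) = matrix (x ℕ.* a ℕ.+ c) (x ℕ.* b ℕ.+ d) a b

snoc : Matrix → ℕ → Matrix
snoc (matrix a b c d) x = matrix (x ℕ.* a ℕ.+ b) a (x ℕ.* c ℕ.+ d) c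

-- (qₙ qₙ₋₁ ; pₙ pₙ₋₁) for the convergents pₙ/qₙ of [0; s 0, s 1, …].
continuants : (ℕ → ℕ) → ℕ → Matrix
continuants s zero    = matrix 1 0 0 1
continuants s (suc n) = cons (s 0) (continuants (s ∘ suc) n)

-- Associativity of the matrix product. Three of the four entries agree by computation, so only the
-- upper left one needs the solver.
cons-snoc : ∀ x m y → cons x (snoc m y) ≡ snoc (cons x m) y
cons-snoc x (matrix a b c d) y = cong (λ e → matrix e (x ℕ.* a ℕ.+ c) (y ℕ.* a ℕ.+ b) a) (eq x y a b c d)
  where
  open ℕ.+-*-Solver
  eq : ∀ x y a b c d → x ℕ.* (y ℕ.* a ℕ.+ b) ℕ.+ (y ℕ.* c ℕ.+ d) ≡
                       y ℕ.* (x ℕ.* a ℕ.+ c) ℕ.+ (x ℕ.* b ℕ.+ d)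
  eq = solve 6 (λ x y a b c d →
    x :* (y :* a :+ b) :+ (y :* c :+ d) := y :* (x :* a :+ c) :+ (x :* b :+ d)) refl

-- The product of the factors `(x 1 ; 1 0)` is built from the left. Growing it from the right as
-- well is what allows a word to be compared with its reversal.
continuants-snoc : ∀ s n → continuants s (suc n) ≡ snoc (continuants s n) (s n)
continuants-snoc s zero    rewrite ℕ.*-zeroʳ (s 0) = refl
continuants-snoc s (suc n) = trans
  (cong (cons (s 0)) (continuants-snoc (s ∘ suc) n))
  (cons-snoc (s 0) (continuants (s ∘ suc) n) (s (suc n)))

-- Each factor `(x 1 ; 1 0)` is symmetric, so transposing a product reverses the order of its
-- factors. The hypothesis says that the first `n` letters of `t` are those of `s` read backwards.
-- Removing the first letter of `s` removes the last one of `t`, hence `s` is shifted in the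
-- induction while `t` stays fixed.
continuants-reverse : ∀ n s t → (∀ i j → suc (i ℕ.+ j) ≡ n → s i ≡ t j) →
                      continuants s n ≡ transpose (continuants t n)
continuants-reverse zero    s t s≡t = refl
continuants-reverse (suc n) s t s≡t = begin
  cons (s 0) (continuants (s ∘ suc) n)      ≡⟨ cong₂ cons (s≡t 0 n refl) (continuants-reverse n (s ∘ suc) t
                                                (λ i j → s≡t (suc i) j ∘ cong suc)) ⟩
  transpose (snoc (continuants t n) (t n))  ≡⟨ cong transpose (continuants-snoc t n) ⟨
  transpose (continuants t (suc n))         ∎
  where open ≡-Reasoning

-- A palindrome is its own reversal, so `continuants-reverse` with `s = t` makes the matrix equal to
-- its transpose. In classical terms, qₙ₋₁ = pₙ.
palindrome⇒symmetric : ∀ a n → Palindrome (word a n) →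
  let m = continuants (a ∘ suc) n in e₁₂ m ≡ e₂₁ m
palindrome⇒symmetric a n palindrome =
  cong e₁₂ (continuants-reverse n (a ∘ suc) (a ∘ suc) mirror)
  where
  open ≡-Reasoning
  mirror : ∀ i j → suc (i ℕ.+ j) ≡ n → a (suc i) ≡ a (suc j)
  mirror i j refl = begin
    a (suc i)                             ≡⟨ cong (a ∘ suc) (toℕ-fromℕ< i<n) ⟨
    a (suc (toℕ (fromℕ< i<n)))            ≡⟨ palindrome (fromℕ< i<n) ⟩
    a (suc (toℕ (opposite (fromℕ< i<n)))) ≡⟨ cong (a ∘ suc) (opposite-prop (fromℕ< i<n)) ⟩
    a (suc (n ℕ.∸ suc (toℕ (fromℕ< i<n))))  ≡⟨ cong (λ k → a (suc (n ℕ.∸ suc k))) (toℕ-fromℕ< i<n) ⟩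
    a (suc (i ℕ.+ j ℕ.∸ i))               ≡⟨ cong (a ∘ suc) (ℕ.m+n∸m≡n i j) ⟩
    a (suc j)                             ∎
    where i<n = ℕ.s≤s (ℕ.m≤m+n i j)

-- Growth of continuants.

Positive : (ℕ → ℕ) → Set
Positive s = ∀ i → 1 ℕ.≤ s i

module _ where
  open ℕ.≤-Reasoning

  -- The lower left entry of `cons x m` is `e₁₁ m`, and `x` is at least 1. This yields p ≤ q, which
  -- later bounds Q by a multiple of q and controls errors multiplied by p.
  e₂₁≤e₁₁ : ∀ {s} → Positive s → ∀ n → e₂₁ (continuants s n) ℕ.≤ e₁₁ (continuants s n)
  e₂₁≤e₁₁     s>0 zero    = ℕ.z≤n
  e₂₁≤e₁₁ {s} s>0 (suc n) = begin
    e₁₁ m                     ≡⟨ ℕ.*-identityˡ _ ⟨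
    1 ℕ.* e₁₁ m               ≤⟨ ℕ.*-monoˡ-≤ (e₁₁ m) (s>0 0) ⟩
    s 0 ℕ.* e₁₁ m             ≤⟨ ℕ.m≤m+n _ _ ⟩
    s 0 ℕ.* e₁₁ m ℕ.+ e₂₁ m   ∎
    where m = continuants (s ∘ suc) n

  1≤e₁₁ : ∀ {s} → Positive s → ∀ n → 1 ℕ.≤ e₁₁ (continuants s n)
  1≤e₁₁ s>0 zero    = ℕ.≤-refl
  1≤e₁₁ s>0 (suc n) = ℕ.≤-trans (1≤e₁₁ (s>0 ∘ suc) n) (e₂₁≤e₁₁ s>0 (suc n))

  -- Linear growth is enough to make q arbitrarily large along the palindromic prefixes. Each
  -- further letter adds at least `e₂₁ m`, which is the leading continuant of a word one letter
  -- shorter and so at least 1. For the empty word that entry is 0, hence the separate case of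
  -- length 1.
  n≤e₁₁ : ∀ {s} → Positive s → ∀ n → n ℕ.≤ e₁₁ (continuants s n)
  n≤e₁₁     s>0 zero          = ℕ.z≤n
  n≤e₁₁     s>0 (suc zero)    = 1≤e₁₁ s>0 1
  n≤e₁₁ {s} s>0 (suc (suc n)) = begin
    2 ℕ.+ n                   ≡⟨ ℕ.+-comm 1 (suc n) ⟩
    suc n ℕ.+ 1               ≤⟨ ℕ.+-mono-≤ (n≤e₁₁ (s>0 ∘ suc) (suc n)) (1≤e₁₁ (s>0 ∘ suc ∘ suc) n) ⟩
    e₁₁ m ℕ.+ e₂₁ m           ≡⟨ cong (ℕ._+ e₂₁ m) (ℕ.*-identityˡ _) ⟨
    1 ℕ.* e₁₁ m ℕ.+ e₂₁ m     ≤⟨ ℕ.+-monoˡ-≤ (e₂₁ m) (ℕ.*-monoˡ-≤ (e₁₁ m) (s>0 0)) ⟩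
    s 0 ℕ.* e₁₁ m ℕ.+ e₂₁ m   ∎
    where m = continuants (s ∘ suc) (suc n)

-- Integers inside the rationals and elementary inequalities.

ι : ℕ → ℚ
ι n = ℤ⇒ℚ (+ n)

ℤ⇒ℚ-+ : ∀ i j → ℤ⇒ℚ (i ℤ.+ j) ≡ ℤ⇒ℚ i ℚ.+ ℤ⇒ℚ j
ℤ⇒ℚ-+ i j rewrite ℤ⇒ℚ-mkℚ i | ℤ⇒ℚ-mkℚ j =
  sym (cong₂ (λ k l → ℤ⇒ℚ (k ℤ.+ l)) (ℤ.*-identityʳ i) (ℤ.*-identityʳ j))

ℤ⇒ℚ-* : ∀ i j → ℤ⇒ℚ (i ℤ.* j) ≡ ℤ⇒ℚ i ℚ.* ℤ⇒ℚ j
ℤ⇒ℚ-* i j rewrite ℤ⇒ℚ-mkℚ i | ℤ⇒ℚ-mkℚ j = refl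

ι-+ : ∀ m n → ι (m ℕ.+ n) ≡ ι m ℚ.+ ι n
ι-+ m n = trans (cong ℤ⇒ℚ (ℤ.pos-+ m n)) (ℤ⇒ℚ-+ (+ m) (+ n))

ι-* : ∀ m n → ι (m ℕ.* n) ≡ ι m ℚ.* ι n
ι-* m n = trans (cong ℤ⇒ℚ (ℤ.pos-* m n)) (ℤ⇒ℚ-* (+ m) (+ n))

ι-*-+ : ∀ l m n → ι (l ℕ.* m ℕ.+ n) ≡ ι l ℚ.* ι m ℚ.+ ι n
ι-*-+ l m n = trans (ι-+ (l ℕ.* m) n) (cong (ℚ._+ ι n) (ι-* l m))

ι-mono : ∀ {m n} → m ℕ.≤ n → ι m ℚ.≤ ι n
ι-mono {m} {n} m≤n = ℤ⇒ℚ-mono {+ m} {+ n} (ℤ.+≤+ m≤n)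

0≤ι : ∀ n → 0ℚ ℚ.≤ ι n
0≤ι n = ι-mono {0} {n} ℕ.z≤n

ι-cancel-≤ : ∀ {m n} → ι m ℚ.≤ ι n → m ℕ.≤ n
ι-cancel-≤ {m} {n} ιm≤ιn rewrite ℤ⇒ℚ-mkℚ (+ m) | ℤ⇒ℚ-mkℚ (+ n) =
  ℤ.drop‿+≤+ (subst₂ ℤ._≤_ (ℤ.*-identityʳ (+ m)) (ℤ.*-identityʳ (+ n)) (ℚ.drop-*≤* ιm≤ιn))

∣ℤ⇒ℚ∣ : ∀ i → ℚ.∣ ℤ⇒ℚ i ∣ ≡ ι ℤ.∣ i ∣
∣ℤ⇒ℚ∣ (+ n)    = ℚ.0≤p⇒∣p∣≡p (0≤ι n)
∣ℤ⇒ℚ∣ -[1+ n ] = trans (ℚ.∣-p∣≡∣p∣ (ι (suc n))) (ℚ.0≤p⇒∣p∣≡p (0≤ι (suc n)))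

0<1 : 0ℚ ℚ.< 1ℚ
0<1 = ℚ.positive⁻¹ 1ℚ

0≤1 : 0ℚ ℚ.≤ 1ℚ
0≤1 = ℚ.<⇒≤ 0<1

0≤p+q : ∀ {p q} → 0ℚ ℚ.≤ p → 0ℚ ℚ.≤ q → 0ℚ ℚ.≤ p ℚ.+ q
0≤p+q = ℚ.+-mono-≤

0≤p*q : ∀ {p q} → 0ℚ ℚ.≤ p → 0ℚ ℚ.≤ q → 0ℚ ℚ.≤ p ℚ.* q
0≤p*q 0≤p 0≤q = *-mono-≤ ℚ.≤-refl ℚ.≤-refl 0≤p 0≤q

p≤p+q : ∀ {p q} → 0ℚ ℚ.≤ q → p ℚ.≤ p ℚ.+ q
p≤p+q {p} {q} 0≤q = subst (ℚ._≤ p ℚ.+ q) (ℚ.+-identityʳ p) (ℚ.+-monoʳ-≤ p 0≤q)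

*-monoˡ : ∀ {p q} r → 0ℚ ℚ.≤ r → p ℚ.≤ q → r ℚ.* p ℚ.≤ r ℚ.* q
*-monoˡ r 0≤r = ℚ.*-monoˡ-≤-nonNeg r {{ℚ.nonNegative 0≤r}}

*-monoʳ : ∀ {p q} r → 0ℚ ℚ.≤ r → p ℚ.≤ q → p ℚ.* r ℚ.≤ q ℚ.* r
*-monoʳ r 0≤r = ℚ.*-monoʳ-≤-nonNeg r {{ℚ.nonNegative 0≤r}}

∣p∣*q≡∣p*q∣ : ∀ p {q} → 0ℚ ℚ.≤ q → ℚ.∣ p ∣ ℚ.* q ≡ ℚ.∣ p ℚ.* q ∣
∣p∣*q≡∣p*q∣ p {q} 0≤q =
  trans (cong (ℚ.∣ p ∣ ℚ.*_) (sym (ℚ.0≤p⇒∣p∣≡p 0≤q))) (sym (ℚ.∣p*q∣≡∣p∣*∣q∣ p q))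

0≤inv : ∀ {p} → 0ℚ ℚ.< p → 0ℚ ℚ.≤ inv p
0≤inv {p} 0<p with p ℚ.≟ 0ℚ
... | yes _   = ℚ.≤-refl
... | no  p≢0 = ℚ.<⇒≤ (ℚ.positive⁻¹ _ {{ℚ.1/pos⇒pos p {{ℚ.positive 0<p}}}})

-- Convergents and their approximation errors.

1≤convergent : ∀ {s} → Positive s → ∀ n → 1ℚ ℚ.≤ convergent s n
1≤convergent s>0 zero    = ι-mono (s>0 0)
1≤convergent s>0 (suc n) = ℚ.≤-trans (ι-mono (s>0 0))
  (p≤p+q (0≤inv (ℚ.<-≤-trans 0<1 (1≤convergent (s>0 ∘ suc) n))))

-- Ensures that `inv` is a genuine reciprocal wherever a convergent is inverted, rather than its
-- default value 0.
convergent≢0 : ∀ {s} → Positive s → ∀ n → convergent s n ≢ 0ℚ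
convergent≢0 s>0 n eq =
  ℚ.<-irrefl refl (ℚ.<-≤-trans 0<1 (subst (1ℚ ℚ.≤_) eq (1≤convergent s>0 n)))

-- Every factor `(x 1 ; 1 0)` has determinant -1. The absolute value absorbs the alternating sign.
continuants-det : ∀ s n → let matrix a b c d = continuants s n in
  ℚ.∣ ι a ℚ.* ι d ℚ.- ι b ℚ.* ι c ∣ ≡ 1ℚ
continuants-det s zero    = refl
continuants-det s (suc n) = begin
  ℚ.∣ ι (s 0 ℕ.* a ℕ.+ c) ℚ.* ι b ℚ.- ι (s 0 ℕ.* b ℕ.+ d) ℚ.* ι a ∣
    ≡⟨ cong₂ (λ u v → ℚ.∣ u ℚ.* ι b ℚ.- v ℚ.* ι a ∣) (ι-*-+ (s 0) a c) (ι-*-+ (s 0) b d) ⟩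
  ℚ.∣ (ι (s 0) ℚ.* ι a ℚ.+ ι c) ℚ.* ι b ℚ.- (ι (s 0) ℚ.* ι b ℚ.+ ι d) ℚ.* ι a ∣
    ≡⟨ cong ℚ.∣_∣ (eq (ι (s 0)) (ι a) (ι b) (ι c) (ι d)) ⟩
  ℚ.∣ ℚ.- (ι a ℚ.* ι d ℚ.- ι b ℚ.* ι c) ∣
    ≡⟨ ℚ.∣-p∣≡∣p∣ (ι a ℚ.* ι d ℚ.- ι b ℚ.* ι c) ⟩
  ℚ.∣ ι a ℚ.* ι d ℚ.- ι b ℚ.* ι c ∣
    ≡⟨ continuants-det (s ∘ suc) n ⟩
  1ℚ ∎
  where
  open ≡-Reasoning
  m = continuants (s ∘ suc) n
  a = e₁₁ m
  b = e₁₂ m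
  c = e₂₁ m
  d = e₂₂ m
  eq : ∀ x a b c d → (x ℚ.* a ℚ.+ c) ℚ.* b ℚ.- (x ℚ.* b ℚ.+ d) ℚ.* a ≡
                     ℚ.- (a ℚ.* d ℚ.- b ℚ.* c)
  eq = solve 5 (λ x a b c d → (x :* a :+ c) :* b :- (x :* b :+ d) :* a :=
                              :- (a :* d :- b :* c)) refl
    where open +-*-Solver

-- The Möbius action of the continuant matrix: `[s 0; s 1, …]` equals (a t + b)/(c t + d), where `t`
-- is the tail after `n` letters. Both sides are multiplied out, so the only reciprocal to cancel is
-- the one in `convergent` itself.
convergent-tail : ∀ {s} → Positive s → ∀ n j →
  let matrix a b c d = continuants s n
      t              = convergent (λ i → s (n ℕ.+ i)) j
  in convergent s (n ℕ.+ j) ℚ.* (ι c ℚ.* t ℚ.+ ι d) ≡ ι a ℚ.* t ℚ.+ ι b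
convergent-tail {s} s>0 zero    j = eq (convergent s j)
  where
  eq : ∀ t → t ℚ.* (0ℚ ℚ.* t ℚ.+ 1ℚ) ≡ 1ℚ ℚ.* t ℚ.+ 0ℚ
  eq = solve 1 (λ t → t :* (con 0ℚ :* t :+ con 1ℚ) := con 1ℚ :* t :+ con 0ℚ) refl
    where open +-*-Solver
convergent-tail {s} s>0 (suc n) j = begin
  (x ℚ.+ inv u) ℚ.* (ι a ℚ.* t ℚ.+ ι b)
    ≡⟨ ℚ.*-distribʳ-+ _ x (inv u) ⟩
  x ℚ.* (ι a ℚ.* t ℚ.+ ι b) ℚ.+ inv u ℚ.* (ι a ℚ.* t ℚ.+ ι b)
    ≡⟨ cong (λ v → x ℚ.* (ι a ℚ.* t ℚ.+ ι b) ℚ.+ inv u ℚ.* v) (convergent-tail (s>0 ∘ suc) n j) ⟨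
  x ℚ.* (ι a ℚ.* t ℚ.+ ι b) ℚ.+ inv u ℚ.* (u ℚ.* (ι c ℚ.* t ℚ.+ ι d))
    ≡⟨ cong (x ℚ.* (ι a ℚ.* t ℚ.+ ι b) ℚ.+_) (ℚ.*-assoc (inv u) u _) ⟨
  x ℚ.* (ι a ℚ.* t ℚ.+ ι b) ℚ.+ inv u ℚ.* u ℚ.* (ι c ℚ.* t ℚ.+ ι d)
    ≡⟨ cong (λ v → x ℚ.* (ι a ℚ.* t ℚ.+ ι b) ℚ.+ v ℚ.* (ι c ℚ.* t ℚ.+ ι d))
         (inv-inverse u (convergent≢0 (s>0 ∘ suc) (n ℕ.+ j))) ⟩
  x ℚ.* (ι a ℚ.* t ℚ.+ ι b) ℚ.+ 1ℚ ℚ.* (ι c ℚ.* t ℚ.+ ι d)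
    ≡⟨ eq x (ι a) (ι b) (ι c) (ι d) t ⟩
  (x ℚ.* ι a ℚ.+ ι c) ℚ.* t ℚ.+ (x ℚ.* ι b ℚ.+ ι d)
    ≡⟨ cong₂ (λ v w → v ℚ.* t ℚ.+ w) (ι-*-+ (s 0) a c) (ι-*-+ (s 0) b d) ⟨
  ι (s 0 ℕ.* a ℕ.+ c) ℚ.* t ℚ.+ ι (s 0 ℕ.* b ℕ.+ d) ∎
  where
  open ≡-Reasoning
  m = continuants (s ∘ suc) n
  a = e₁₁ m
  b = e₁₂ m
  c = e₂₁ m
  d = e₂₂ m
  x = ι (s 0)
  u = convergent (s ∘ suc) (n ℕ.+ j)
  t = convergent (λ i → s (suc n ℕ.+ i)) j
  eq : ∀ x a b c d t → x ℚ.* (a ℚ.* t ℚ.+ b) ℚ.+ 1ℚ ℚ.* (c ℚ.* t ℚ.+ d) ≡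
                       (x ℚ.* a ℚ.+ c) ℚ.* t ℚ.+ (x ℚ.* b ℚ.+ d)
  eq = solve 6 (λ x a b c d t → x :* (a :* t :+ b) :+ con 1ℚ :* (c :* t :+ d) :=
                                (x :* a :+ c) :* t :+ (x :* b :+ d)) refl
    where open +-*-Solver

-- With w = a t + b, the relation x w = c t + d gives (a x - c) w = a d - b c and (b x - d) w = -(a
-- d - b c) t. Since w ≥ a and w ≥ a t, both errors are at most 1/a. The second one is thus measured
-- against `a` and not against the smaller scale `b`.
möbius-error : ∀ {a b c d t x} → 0ℚ ℚ.≤ a → 0ℚ ℚ.≤ b → 1ℚ ℚ.≤ t →
  ℚ.∣ a ℚ.* d ℚ.- b ℚ.* c ∣ ≡ 1ℚ → x ℚ.* (a ℚ.* t ℚ.+ b) ≡ c ℚ.* t ℚ.+ d →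
  ℚ.∣ a ℚ.* x ℚ.- c ∣ ℚ.* a ℚ.≤ 1ℚ × ℚ.∣ b ℚ.* x ℚ.- d ∣ ℚ.* a ℚ.≤ 1ℚ
möbius-error {a} {b} {c} {d} {t} {x} 0≤a 0≤b 1≤t det≡1 xw≡v = (begin
  ℚ.∣ a ℚ.* x ℚ.- c ∣ ℚ.* a            ≤⟨ *-monoˡ _ (ℚ.0≤∣p∣ (a ℚ.* x ℚ.- c)) a≤w ⟩
  ℚ.∣ a ℚ.* x ℚ.- c ∣ ℚ.* w            ≡⟨ ∣p∣*q≡∣p*q∣ (a ℚ.* x ℚ.- c) 0≤w ⟩
  ℚ.∣ (a ℚ.* x ℚ.- c) ℚ.* w ∣          ≡⟨ cong ℚ.∣_∣ (eq₁ a c x w) ⟩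
  ℚ.∣ a ℚ.* (x ℚ.* w) ℚ.- c ℚ.* w ∣    ≡⟨ cong (λ v → ℚ.∣ a ℚ.* v ℚ.- c ℚ.* w ∣) xw≡v ⟩
  ℚ.∣ a ℚ.* (c ℚ.* t ℚ.+ d) ℚ.- c ℚ.* w ∣  ≡⟨ cong ℚ.∣_∣ (eq₂ a b c d t) ⟩
  ℚ.∣ a ℚ.* d ℚ.- b ℚ.* c ∣            ≡⟨ det≡1 ⟩
  1ℚ                                   ∎)
  , ℚ.*-cancelʳ-≤-pos t {{ℚ.positive 0<t}} (begin
  ℚ.∣ b ℚ.* x ℚ.- d ∣ ℚ.* a ℚ.* t      ≡⟨ ℚ.*-assoc ℚ.∣ b ℚ.* x ℚ.- d ∣ a t ⟩
  ℚ.∣ b ℚ.* x ℚ.- d ∣ ℚ.* (a ℚ.* t)    ≤⟨ *-monoˡ _ (ℚ.0≤∣p∣ (b ℚ.* x ℚ.- d)) (p≤p+q 0≤b) ⟩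
  ℚ.∣ b ℚ.* x ℚ.- d ∣ ℚ.* w            ≡⟨ ∣p∣*q≡∣p*q∣ (b ℚ.* x ℚ.- d) 0≤w ⟩
  ℚ.∣ (b ℚ.* x ℚ.- d) ℚ.* w ∣          ≡⟨ cong ℚ.∣_∣ (eq₁ b d x w) ⟩
  ℚ.∣ b ℚ.* (x ℚ.* w) ℚ.- d ℚ.* w ∣    ≡⟨ cong (λ v → ℚ.∣ b ℚ.* v ℚ.- d ℚ.* w ∣) xw≡v ⟩
  ℚ.∣ b ℚ.* (c ℚ.* t ℚ.+ d) ℚ.- d ℚ.* w ∣  ≡⟨ cong ℚ.∣_∣ (eq₃ a b c d t) ⟩
  ℚ.∣ ℚ.- ((a ℚ.* d ℚ.- b ℚ.* c) ℚ.* t) ∣  ≡⟨ ℚ.∣-p∣≡∣p∣ ((a ℚ.* d ℚ.- b ℚ.* c) ℚ.* t) ⟩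
  ℚ.∣ (a ℚ.* d ℚ.- b ℚ.* c) ℚ.* t ∣    ≡⟨ ∣p∣*q≡∣p*q∣ (a ℚ.* d ℚ.- b ℚ.* c) 0≤t ⟨
  ℚ.∣ a ℚ.* d ℚ.- b ℚ.* c ∣ ℚ.* t      ≡⟨ cong (ℚ._* t) det≡1 ⟩
  1ℚ ℚ.* t                             ∎)
  where
  open ℚ.≤-Reasoning
  w   = a ℚ.* t ℚ.+ b
  0<t = ℚ.<-≤-trans 0<1 1≤t
  0≤t = ℚ.<⇒≤ 0<t
  0≤w = 0≤p+q (0≤p*q 0≤a 0≤t) 0≤b
  a≤w = begin
    a                    ≡⟨ ℚ.*-identityʳ a ⟨
    a ℚ.* 1ℚ             ≤⟨ *-monoˡ a 0≤a 1≤t ⟩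
    a ℚ.* t              ≤⟨ p≤p+q 0≤b ⟩
    a ℚ.* t ℚ.+ b        ∎
  eq₁ : ∀ a c x w → (a ℚ.* x ℚ.- c) ℚ.* w ≡ a ℚ.* (x ℚ.* w) ℚ.- c ℚ.* w
  eq₁ = solve 4 (λ a c x w → (a :* x :- c) :* w := a :* (x :* w) :- c :* w) refl
    where open +-*-Solver
  eq₂ : ∀ a b c d t → a ℚ.* (c ℚ.* t ℚ.+ d) ℚ.- c ℚ.* (a ℚ.* t ℚ.+ b) ≡ a ℚ.* d ℚ.- b ℚ.* c
  eq₂ = solve 5 (λ a b c d t →
    a :* (c :* t :+ d) :- c :* (a :* t :+ b) := a :* d :- b :* c) refl
    where open +-*-Solver
  eq₃ : ∀ a b c d t → b ℚ.* (c ℚ.* t ℚ.+ d) ℚ.- d ℚ.* (a ℚ.* t ℚ.+ b) ≡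
                      ℚ.- ((a ℚ.* d ℚ.- b ℚ.* c) ℚ.* t)
  eq₃ = solve 5 (λ a b c d t →
    b :* (c :* t :+ d) :- d :* (a :* t :+ b) := :- ((a :* d :- b :* c) :* t)) refl
    where open +-*-Solver

-- As `a 0` vanishes, `x` is the reciprocal of `u = [a 1; a 2, …]`, which exchanges numerator and
-- denominator in `convergent-tail`. The index `suc (n + j)` accounts for `a 0`, the `n` letters in
-- the matrix and the tail.
convergent-error : ∀ {a} → a 0 ≡ 0 → Positive (a ∘ suc) → ∀ n j →
  let matrix q q⁻ p p⁻ = continuants (a ∘ suc) n
      x                = convergent a (suc (n ℕ.+ j))
  in ℚ.∣ ι q ℚ.* x ℚ.- ι p ∣ ℚ.* ι q ℚ.≤ 1ℚ × ℚ.∣ ι q⁻ ℚ.* x ℚ.- ι p⁻ ∣ ℚ.* ι q ℚ.≤ 1ℚ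
convergent-error {a} a₀≡0 a>0 n j =
  möbius-error (0≤ι (e₁₁ m)) (0≤ι (e₁₂ m)) (1≤convergent (λ i → a>0 (n ℕ.+ i)) j)
    (continuants-det (a ∘ suc) n) (begin
  (ι (a 0) ℚ.+ inv u) ℚ.* (ι (e₁₁ m) ℚ.* t ℚ.+ ι (e₁₂ m))
    ≡⟨ cong₂ ℚ._*_ (trans (cong (λ k → ι k ℚ.+ inv u) a₀≡0) (ℚ.+-identityˡ (inv u)))
         (sym (convergent-tail a>0 n j)) ⟩
  inv u ℚ.* (u ℚ.* (ι (e₂₁ m) ℚ.* t ℚ.+ ι (e₂₂ m)))
    ≡⟨ ℚ.*-assoc (inv u) u _ ⟨
  inv u ℚ.* u ℚ.* (ι (e₂₁ m) ℚ.* t ℚ.+ ι (e₂₂ m))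
    ≡⟨ cong (ℚ._* (ι (e₂₁ m) ℚ.* t ℚ.+ ι (e₂₂ m))) (inv-inverse u (convergent≢0 a>0 (n ℕ.+ j))) ⟩
  1ℚ ℚ.* (ι (e₂₁ m) ℚ.* t ℚ.+ ι (e₂₂ m))
    ≡⟨ ℚ.*-identityˡ _ ⟩
  ι (e₂₁ m) ℚ.* t ℚ.+ ι (e₂₂ m) ∎)
  where
  open ≡-Reasoning
  m = continuants (a ∘ suc) n
  u = convergent (a ∘ suc) (n ℕ.+ j)
  t = convergent (λ i → a (suc n ℕ.+ i)) j

-- Distance to the nearest integer and the Archimedean property.

p≤∣p∣ : ∀ p → p ℚ.≤ ℚ.∣ p ∣
p≤∣p∣ p with ℚ.≤-total 0ℚ p
... | inj₁ 0≤p = ℚ.≤-reflexive (sym (ℚ.0≤p⇒∣p∣≡p 0≤p))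
... | inj₂ p≤0 = ℚ.≤-trans p≤0 (ℚ.0≤∣p∣ p)

0≤distℤ : ∀ p → 0ℚ ℚ.≤ distℤ p
0≤distℤ p with distℤ-attained p
... | i , eq = subst (0ℚ ℚ.≤_) (sym eq) (ℚ.0≤∣p∣ (p ℚ.- ℤ⇒ℚ i))

-- The multiplier c p + d q may be negative, whereas the theorem ranges over natural multipliers. A
-- change of sign is absorbed by approximating with `- j`.
distℤ-∣∣ : ∀ i p j → distℤ (ι ℤ.∣ i ∣ ℚ.* p) ℚ.≤ ℚ.∣ ℤ⇒ℚ i ℚ.* p ℚ.- ℤ⇒ℚ j ∣
distℤ-∣∣ (+ n)    p j = distℤ-least (ι n ℚ.* p) j
distℤ-∣∣ -[1+ n ] p j = begin
  distℤ (ι (suc n) ℚ.* p)                        ≤⟨ distℤ-least (ι (suc n) ℚ.* p) (ℤ.- j) ⟩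
  ℚ.∣ ι (suc n) ℚ.* p ℚ.- ℤ⇒ℚ (ℤ.- j) ∣          ≡⟨ cong (λ k → ℚ.∣ ι (suc n) ℚ.* p ℚ.- k ∣) (ℤ⇒ℚ-neg j) ⟩
  ℚ.∣ ι (suc n) ℚ.* p ℚ.- ℚ.- ℤ⇒ℚ j ∣            ≡⟨ ℚ.∣-p∣≡∣p∣ (ι (suc n) ℚ.* p ℚ.- ℚ.- ℤ⇒ℚ j) ⟨
  ℚ.∣ ℚ.- (ι (suc n) ℚ.* p ℚ.- ℚ.- ℤ⇒ℚ j) ∣      ≡⟨ cong ℚ.∣_∣ (eq (ι (suc n)) p (ℤ⇒ℚ j)) ⟩
  ℚ.∣ ℚ.- ι (suc n) ℚ.* p ℚ.- ℤ⇒ℚ j ∣            ∎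
  where
  open ℚ.≤-Reasoning
  eq : ∀ i p j → ℚ.- (i ℚ.* p ℚ.- ℚ.- j) ≡ ℚ.- i ℚ.* p ℚ.- j
  eq = solve 3 (λ i p j → :- (i :* p :- :- j) := :- i :* p :- j) refl
    where open +-*-Solver

archimedean : ∀ p {ε} → 0ℚ ℚ.< ε → ∃[ n ] p ℚ.≤ ι n ℚ.* ε
archimedean p {ε} ε>0 = let (η , η>0 , εη≡1) = quotient ε>0 0<1 in
  -- Here `η` is 1/ε. The absolute value makes the ceiling of p/ε a natural number and never
  -- decreases it.
  ℤ.∣ ℚ.ceiling (p ℚ.* η) ∣ , (begin
  p                                          ≡⟨ ℚ.*-identityʳ p ⟨
  p ℚ.* 1ℚ                                   ≡⟨ cong (p ℚ.*_) εη≡1 ⟨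
  p ℚ.* (ε ℚ.* η)                            ≡⟨ eq p ε η ⟩
  p ℚ.* η ℚ.* ε                              ≤⟨ *-monoʳ ε (ℚ.<⇒≤ ε>0) (≤-ceiling (p ℚ.* η)) ⟩
  ℤ⇒ℚ (ℚ.ceiling (p ℚ.* η)) ℚ.* ε            ≤⟨ *-monoʳ ε (ℚ.<⇒≤ ε>0) (p≤∣p∣ (ℤ⇒ℚ (ℚ.ceiling (p ℚ.* η)))) ⟩
  ℚ.∣ ℤ⇒ℚ (ℚ.ceiling (p ℚ.* η)) ∣ ℚ.* ε      ≡⟨ cong (ℚ._* ε) (∣ℤ⇒ℚ∣ (ℚ.ceiling (p ℚ.* η))) ⟩
  ι ℤ.∣ ℚ.ceiling (p ℚ.* η) ∣ ℚ.* ε          ∎)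
  where
  open ℚ.≤-Reasoning
  eq : ∀ p ε η → p ℚ.* (ε ℚ.* η) ≡ p ℚ.* η ℚ.* ε
  eq = solve 3 (λ p ε η → p :* (ε :* η) := p :* η :* ε) refl
    where open +-*-Solver

-- Rational estimates for a point and its homographic image.

2ℚ : ℚ
2ℚ = 1ℚ ℚ.+ 1ℚ

-- Here η = 1/q², so replacing `y` by `x` moves `r * y` by at most r η ≤ 1/q. This adds 1 to the
-- scaled error and is the origin of the constant 2.
perturb : ∀ {q r p x y η} → 0ℚ ℚ.≤ r → r ℚ.≤ q → (q ℚ.* q) ℚ.* η ≡ 1ℚ → ℚ.∣ y ℚ.- x ∣ ℚ.≤ η →
  ℚ.∣ r ℚ.* y ℚ.- p ∣ ℚ.* q ℚ.≤ 1ℚ → ℚ.∣ r ℚ.* x ℚ.- p ∣ ℚ.* q ℚ.≤ 2ℚ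
perturb {q} {r} {p} {x} {y} {η} 0≤r r≤q qqη≡1 y-x≤η h = begin
  ℚ.∣ r ℚ.* x ℚ.- p ∣ ℚ.* q
    ≡⟨ cong (λ z → ℚ.∣ z ∣ ℚ.* q) (eq₁ r x y p) ⟩
  ℚ.∣ (r ℚ.* y ℚ.- p) ℚ.- (y ℚ.- x) ℚ.* r ∣ ℚ.* q
    ≤⟨ *-monoʳ q 0≤q (ℚ.∣p-q∣≤∣p∣+∣q∣ (r ℚ.* y ℚ.- p) ((y ℚ.- x) ℚ.* r)) ⟩
  (ℚ.∣ r ℚ.* y ℚ.- p ∣ ℚ.+ ℚ.∣ (y ℚ.- x) ℚ.* r ∣) ℚ.* q
    ≡⟨ ℚ.*-distribʳ-+ q ℚ.∣ r ℚ.* y ℚ.- p ∣ ℚ.∣ (y ℚ.- x) ℚ.* r ∣ ⟩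
  ℚ.∣ r ℚ.* y ℚ.- p ∣ ℚ.* q ℚ.+ ℚ.∣ (y ℚ.- x) ℚ.* r ∣ ℚ.* q
    ≡⟨ cong (λ z → ℚ.∣ r ℚ.* y ℚ.- p ∣ ℚ.* q ℚ.+ z ℚ.* q) (∣p∣*q≡∣p*q∣ (y ℚ.- x) 0≤r) ⟨
  ℚ.∣ r ℚ.* y ℚ.- p ∣ ℚ.* q ℚ.+ ℚ.∣ y ℚ.- x ∣ ℚ.* r ℚ.* q
    ≤⟨ ℚ.+-mono-≤ h (*-monoʳ q 0≤q (*-mono-≤ (ℚ.0≤∣p∣ (y ℚ.- x)) 0≤r y-x≤η r≤q)) ⟩
  1ℚ ℚ.+ η ℚ.* q ℚ.* q
    ≡⟨ cong (1ℚ ℚ.+_) (trans (eq₂ q η) qqη≡1) ⟩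
  1ℚ ℚ.+ 1ℚ ∎
  where
  open ℚ.≤-Reasoning
  0≤q = ℚ.≤-trans 0≤r r≤q
  eq₁ : ∀ r x y p → r ℚ.* x ℚ.- p ≡ (r ℚ.* y ℚ.- p) ℚ.- (y ℚ.- x) ℚ.* r
  eq₁ = solve 4 (λ r x y p → r :* x :- p := (r :* y :- p) :- (y :- x) :* r) refl
    where open +-*-Solver
  eq₂ : ∀ q η → η ℚ.* q ℚ.* q ≡ (q ℚ.* q) ℚ.* η
  eq₂ = solve 2 (λ q η → η :* q :* q := (q :* q) :* η) refl
    where open +-*-Solver

∣us+vt∣k≤ : ∀ u v s t {k M N} → ℚ.∣ s ∣ ℚ.* k ℚ.≤ M → ℚ.∣ t ∣ ℚ.* k ℚ.≤ N → 0ℚ ℚ.≤ k →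
  ℚ.∣ u ℚ.* s ℚ.+ v ℚ.* t ∣ ℚ.* k ℚ.≤ ℚ.∣ u ∣ ℚ.* M ℚ.+ ℚ.∣ v ∣ ℚ.* N
∣us+vt∣k≤ u v s t {k} {M} {N} hs ht 0≤k = begin
  ℚ.∣ u ℚ.* s ℚ.+ v ℚ.* t ∣ ℚ.* k
    ≤⟨ *-monoʳ k 0≤k (ℚ.∣p+q∣≤∣p∣+∣q∣ (u ℚ.* s) (v ℚ.* t)) ⟩
  (ℚ.∣ u ℚ.* s ∣ ℚ.+ ℚ.∣ v ℚ.* t ∣) ℚ.* k
    ≡⟨ cong₂ (λ y z → (y ℚ.+ z) ℚ.* k) (ℚ.∣p*q∣≡∣p∣*∣q∣ u s) (ℚ.∣p*q∣≡∣p∣*∣q∣ v t) ⟩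
  (ℚ.∣ u ∣ ℚ.* ℚ.∣ s ∣ ℚ.+ ℚ.∣ v ∣ ℚ.* ℚ.∣ t ∣) ℚ.* k
    ≡⟨ eq ℚ.∣ u ∣ ℚ.∣ v ∣ ℚ.∣ s ∣ ℚ.∣ t ∣ k ⟩
  ℚ.∣ u ∣ ℚ.* (ℚ.∣ s ∣ ℚ.* k) ℚ.+ ℚ.∣ v ∣ ℚ.* (ℚ.∣ t ∣ ℚ.* k)
    ≤⟨ ℚ.+-mono-≤ (*-monoˡ _ (ℚ.0≤∣p∣ u) hs) (*-monoˡ _ (ℚ.0≤∣p∣ v) ht) ⟩
  ℚ.∣ u ∣ ℚ.* M ℚ.+ ℚ.∣ v ∣ ℚ.* N ∎
  where
  open ℚ.≤-Reasoning
  eq : ∀ u v s t k → (u ℚ.* s ℚ.+ v ℚ.* t) ℚ.* k ≡ u ℚ.* (s ℚ.* k) ℚ.+ v ℚ.* (t ℚ.* k)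
  eq = solve 5 (λ u v s t k → (u :* s :+ v :* t) :* k := u :* (s :* k) :+ v :* (t :* k)) refl
    where open +-*-Solver

∣up+vq∣≤ : ∀ u v {p q} → 0ℚ ℚ.≤ p → p ℚ.≤ q →
  ℚ.∣ u ℚ.* p ℚ.+ v ℚ.* q ∣ ℚ.≤ (ℚ.∣ u ∣ ℚ.+ ℚ.∣ v ∣) ℚ.* q
∣up+vq∣≤ u v {p} {q} 0≤p p≤q = begin
  ℚ.∣ u ℚ.* p ℚ.+ v ℚ.* q ∣              ≤⟨ ℚ.∣p+q∣≤∣p∣+∣q∣ (u ℚ.* p) (v ℚ.* q) ⟩
  ℚ.∣ u ℚ.* p ∣ ℚ.+ ℚ.∣ v ℚ.* q ∣        ≡⟨ cong₂ ℚ._+_ (∣p∣*q≡∣p*q∣ u 0≤p)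
                                            (∣p∣*q≡∣p*q∣ v (ℚ.≤-trans 0≤p p≤q)) ⟨
  ℚ.∣ u ∣ ℚ.* p ℚ.+ ℚ.∣ v ∣ ℚ.* q        ≤⟨ ℚ.+-monoˡ-≤ _ (*-monoˡ ℚ.∣ u ∣ (ℚ.0≤∣p∣ u) p≤q) ⟩
  ℚ.∣ u ∣ ℚ.* q ℚ.+ ℚ.∣ v ∣ ℚ.* q        ≡⟨ ℚ.*-distribʳ-+ q ℚ.∣ u ∣ ℚ.∣ v ∣ ⟨
  (ℚ.∣ u ∣ ℚ.+ ℚ.∣ v ∣) ℚ.* q            ∎
  where open ℚ.≤-Reasoning

-- The rationals `x` and `y` stand for terms of the sequences representing α and β, so no limits
-- occur in these estimates.
module HomographyEstimates
  {a b c d x y q p r : ℚ} (1≤q : 1ℚ ℚ.≤ q)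
  (qx≈p : ℚ.∣ q ℚ.* x ℚ.- p ∣ ℚ.* q ℚ.≤ 2ℚ)
  where

  private
    Q : ℚ
    Q = c ℚ.* p ℚ.+ d ℚ.* q

    0≤q : 0ℚ ℚ.≤ q
    0≤q = ℚ.≤-trans 0≤1 1≤q

  -- The error equals c (p x - r) + d (q x - p). It is here that p has to be a good multiplier too.
  Qx-near-integer : ℚ.∣ p ℚ.* x ℚ.- r ∣ ℚ.* q ℚ.≤ 2ℚ →
    ℚ.∣ Q ℚ.* x ℚ.- (c ℚ.* r ℚ.+ d ℚ.* p) ∣ ℚ.* q ℚ.≤ ℚ.∣ c ∣ ℚ.* 2ℚ ℚ.+ ℚ.∣ d ∣ ℚ.* 2ℚ
  Qx-near-integer px≈r = subst (λ z → ℚ.∣ z ∣ ℚ.* q ℚ.≤ ℚ.∣ c ∣ ℚ.* 2ℚ ℚ.+ ℚ.∣ d ∣ ℚ.* 2ℚ)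
    (eq c d p q r x) (∣us+vt∣k≤ c d (p ℚ.* x ℚ.- r) (q ℚ.* x ℚ.- p) px≈r qx≈p 0≤q)
    where
    eq : ∀ c d p q r x → c ℚ.* (p ℚ.* x ℚ.- r) ℚ.+ d ℚ.* (q ℚ.* x ℚ.- p) ≡
                         (c ℚ.* p ℚ.+ d ℚ.* q) ℚ.* x ℚ.- (c ℚ.* r ℚ.+ d ℚ.* p)
    eq = solve 6 (λ c d p q r x → c :* (p :* x :- r) :+ d :* (q :* x :- p) :=
                                  (c :* p :+ d :* q) :* x :- (c :* r :+ d :* p)) refl
      where open +-*-Solver

  -- The error equals q e + (a - c y)(q x - p), where `e` is the defect of `y` as the image of `x`.
  -- With η = 1/q² the first term contributes at most 1 after scaling by `q`.
  Qy-near-integer : ∀ {η B} → (q ℚ.* q) ℚ.* η ≡ 1ℚ → ℚ.∣ y ∣ ℚ.≤ B →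
    ℚ.∣ y ℚ.* (c ℚ.* x ℚ.+ d) ℚ.- (a ℚ.* x ℚ.+ b) ∣ ℚ.≤ η →
    ℚ.∣ Q ℚ.* y ℚ.- (a ℚ.* p ℚ.+ b ℚ.* q) ∣ ℚ.* q ℚ.≤ 1ℚ ℚ.+ (ℚ.∣ c ∣ ℚ.* B ℚ.+ ℚ.∣ a ∣) ℚ.* 2ℚ
  Qy-near-integer {η} {B} qqη≡1 y≤B homography = begin
    ℚ.∣ Q ℚ.* y ℚ.- (a ℚ.* p ℚ.+ b ℚ.* q) ∣ ℚ.* q
      ≡⟨ cong (λ z → ℚ.∣ z ∣ ℚ.* q) (eq₁ a b c d p q x y) ⟩
    ℚ.∣ q ℚ.* e ℚ.+ (a ℚ.- c ℚ.* y) ℚ.* (q ℚ.* x ℚ.- p) ∣ ℚ.* q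
      ≤⟨ ∣us+vt∣k≤ q (a ℚ.- c ℚ.* y) e (q ℚ.* x ℚ.- p) (*-monoʳ q 0≤q homography) qx≈p 0≤q ⟩
    ℚ.∣ q ∣ ℚ.* (η ℚ.* q) ℚ.+ ℚ.∣ a ℚ.- c ℚ.* y ∣ ℚ.* 2ℚ
      ≡⟨ cong (λ z → z ℚ.* (η ℚ.* q) ℚ.+ ℚ.∣ a ℚ.- c ℚ.* y ∣ ℚ.* 2ℚ) (ℚ.0≤p⇒∣p∣≡p 0≤q) ⟩
    q ℚ.* (η ℚ.* q) ℚ.+ ℚ.∣ a ℚ.- c ℚ.* y ∣ ℚ.* 2ℚ
      ≡⟨ cong (ℚ._+ ℚ.∣ a ℚ.- c ℚ.* y ∣ ℚ.* 2ℚ) (trans (eq₂ q η) qqη≡1) ⟩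
    1ℚ ℚ.+ ℚ.∣ a ℚ.- c ℚ.* y ∣ ℚ.* 2ℚ
      ≤⟨ ℚ.+-monoʳ-≤ 1ℚ (*-monoʳ 2ℚ (0≤p+q 0≤1 0≤1) a-cy) ⟩
    1ℚ ℚ.+ (ℚ.∣ c ∣ ℚ.* B ℚ.+ ℚ.∣ a ∣) ℚ.* 2ℚ ∎
    where
    open ℚ.≤-Reasoning
    e = y ℚ.* (c ℚ.* x ℚ.+ d) ℚ.- (a ℚ.* x ℚ.+ b)
    a-cy = begin
      ℚ.∣ a ℚ.- c ℚ.* y ∣                ≤⟨ ℚ.∣p-q∣≤∣p∣+∣q∣ a (c ℚ.* y) ⟩
      ℚ.∣ a ∣ ℚ.+ ℚ.∣ c ℚ.* y ∣          ≡⟨ ℚ.+-comm ℚ.∣ a ∣ ℚ.∣ c ℚ.* y ∣ ⟩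
      ℚ.∣ c ℚ.* y ∣ ℚ.+ ℚ.∣ a ∣          ≡⟨ cong (ℚ._+ ℚ.∣ a ∣) (ℚ.∣p*q∣≡∣p∣*∣q∣ c y) ⟩
      ℚ.∣ c ∣ ℚ.* ℚ.∣ y ∣ ℚ.+ ℚ.∣ a ∣    ≤⟨ ℚ.+-monoˡ-≤ ℚ.∣ a ∣ (*-monoˡ ℚ.∣ c ∣ (ℚ.0≤∣p∣ c) y≤B) ⟩
      ℚ.∣ c ∣ ℚ.* B ℚ.+ ℚ.∣ a ∣          ∎
    eq₁ : ∀ a b c d p q x y → (c ℚ.* p ℚ.+ d ℚ.* q) ℚ.* y ℚ.- (a ℚ.* p ℚ.+ b ℚ.* q) ≡
      q ℚ.* (y ℚ.* (c ℚ.* x ℚ.+ d) ℚ.- (a ℚ.* x ℚ.+ b)) ℚ.+ (a ℚ.- c ℚ.* y) ℚ.* (q ℚ.* x ℚ.- p)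
    eq₁ = solve 8 (λ a b c d p q x y → (c :* p :+ d :* q) :* y :- (a :* p :+ b :* q) :=
      q :* (y :* (c :* x :+ d) :- (a :* x :+ b)) :+ (a :- c :* y) :* (q :* x :- p)) refl
      where open +-*-Solver
    eq₂ : ∀ q η → q ℚ.* (η ℚ.* q) ≡ (q ℚ.* q) ℚ.* η
    eq₂ = solve 2 (λ q η → q :* (η :* q) := (q :* q) :* η) refl
      where open +-*-Solver

  -- From (c x + d) q = Q + c (q x - p) and an error of at most 2 in the last bracket. Hence Q grows
  -- with q once c x + d stays away from 0.
  Q-large : ∀ {δ} → δ ℚ.≤ ℚ.∣ c ℚ.* x ℚ.+ d ∣ → q ℚ.* δ ℚ.≤ ℚ.∣ Q ∣ ℚ.+ ℚ.∣ c ∣ ℚ.* 2ℚ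
  Q-large {δ} δ≤ = begin
    q ℚ.* δ                                     ≤⟨ *-monoˡ q 0≤q δ≤ ⟩
    q ℚ.* ℚ.∣ c ℚ.* x ℚ.+ d ∣                   ≡⟨ ℚ.*-comm q _ ⟩
    ℚ.∣ c ℚ.* x ℚ.+ d ∣ ℚ.* q                   ≡⟨ ∣p∣*q≡∣p*q∣ (c ℚ.* x ℚ.+ d) 0≤q ⟩
    ℚ.∣ (c ℚ.* x ℚ.+ d) ℚ.* q ∣                 ≡⟨ cong ℚ.∣_∣ (eq c d p q x) ⟩
    ℚ.∣ Q ℚ.+ c ℚ.* e ∣                         ≤⟨ ℚ.∣p+q∣≤∣p∣+∣q∣ Q (c ℚ.* e) ⟩
    ℚ.∣ Q ∣ ℚ.+ ℚ.∣ c ℚ.* e ∣                   ≡⟨ cong (ℚ.∣ Q ∣ ℚ.+_) (ℚ.∣p*q∣≡∣p∣*∣q∣ c e) ⟩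
    ℚ.∣ Q ∣ ℚ.+ ℚ.∣ c ∣ ℚ.* ℚ.∣ e ∣             ≤⟨ ℚ.+-monoʳ-≤ ℚ.∣ Q ∣ (*-monoˡ ℚ.∣ c ∣ (ℚ.0≤∣p∣ c) e≤2) ⟩
    ℚ.∣ Q ∣ ℚ.+ ℚ.∣ c ∣ ℚ.* 2ℚ                  ∎
    where
    open ℚ.≤-Reasoning
    e = q ℚ.* x ℚ.- p
    e≤2 = begin
      ℚ.∣ e ∣              ≡⟨ ℚ.*-identityʳ ℚ.∣ e ∣ ⟨
      ℚ.∣ e ∣ ℚ.* 1ℚ       ≤⟨ *-monoˡ ℚ.∣ e ∣ (ℚ.0≤∣p∣ e) 1≤q ⟩
      ℚ.∣ e ∣ ℚ.* q        ≤⟨ qx≈p ⟩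
      2ℚ                   ∎
    eq : ∀ c d p q x → (c ℚ.* x ℚ.+ d) ℚ.* q ≡ (c ℚ.* p ℚ.+ d ℚ.* q) ℚ.+ c ℚ.* (q ℚ.* x ℚ.- p)
    eq = solve 5 (λ c d p q x → (c :* x :+ d) :* q :=
                                (c :* p :+ d :* q) :+ c :* (q :* x :- p)) refl
      where open +-*-Solver

-- From convergents to the terms of a real number.

Eventually-× : ∀ {P Q : ℕ → Set} → Eventually P → Eventually Q → Eventually λ n → P n × Q n
Eventually-× (M , p) (N , q) = M ℕ.⊔ N , λ n M⊔N≤n →
  p n (ℕ.m⊔n≤o⇒m≤o M N M⊔N≤n) , q n (ℕ.m⊔n≤o⇒n≤o M N M⊔N≤n)

Eventually-map : ∀ {P Q : ℕ → Set} → (∀ n → P n → Q n) → Eventually P → Eventually Q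
Eventually-map f (N , p) = N , λ n N≤n → f n (p n N≤n)

fromℚ-pos : ∀ {ε} → 0ℚ ℚ.< ε → 0ℝ < fromℚ ε
fromℚ-pos {ε} ε>0 = ε , ε>0 , 0 , λ _ _ → ℚ.≤-reflexive (ℚ.+-identityˡ ε)

-- The outer index runs through the convergents, the inner one through the rational sequence of the
-- limit.
fromℚ-convergent : ∀ {s x} → (fromℚ ∘ s) ⟶ x → ∀ {ε} → 0ℚ ℚ.< ε →
  Eventually λ k → Eventually λ m → ℚ.∣ s k ℚ.- seq x m ∣ ℚ.≤ ε
fromℚ-convergent s⟶x {ε} ε>0 = Eventually-map
  (λ { k (δ , δ>0 , h) → Eventually-map (λ m → ℚ.≤-trans (p≤p+q (ℚ.<⇒≤ δ>0))) h })
  (s⟶x (fromℚ ε) (fromℚ-pos ε>0))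

IntegerApproximation : ℝ → ℕ → ℕ → ℕ → Set
IntegerApproximation α q p r = Eventually λ m →
  ℚ.∣ ι q ℚ.* seq α m ℚ.- ι p ∣ ℚ.* ι q ℚ.≤ 2ℚ ×
  ℚ.∣ ι p ℚ.* seq α m ℚ.- ι r ∣ ℚ.* ι q ℚ.≤ 2ℚ

-- The order of choices matters: `q` is fixed first, then η = 1/q², and only then an index `k` so
-- late that `s k` is within η of the eventual terms of `α`.
approximation-through-limit : ∀ {α s} → (fromℚ ∘ s) ⟶ α → ∀ q p r → 1 ℕ.≤ q → p ℕ.≤ q →
  (∀ N → ∃[ k ] N ℕ.≤ k × ℚ.∣ ι q ℚ.* s k ℚ.- ι p ∣ ℚ.* ι q ℚ.≤ 1ℚ
                        × ℚ.∣ ι p ℚ.* s k ℚ.- ι r ∣ ℚ.* ι q ℚ.≤ 1ℚ) →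
  IntegerApproximation α q p r
approximation-through-limit {α} {s} s⟶α q p r 1≤q p≤q near =
  let 0<q                          = ℚ.<-≤-trans 0<1 (ι-mono 1≤q)
      (η , η>0 , qqη≡1)            = quotient (pos*pos 0<q 0<q) 0<1
      (K , close)                  = fromℚ-convergent {s} {α} s⟶α η>0
      (k , K≤k , near₁ , near₂)    = near K
      (M , x≈)                     = close k K≤k
  in M , λ m M≤m →
    perturb {ι q} {ι q} {ι p} {seq α m} {s k} (0≤ι q) ℚ.≤-refl qqη≡1 (x≈ m M≤m) near₁ ,
    perturb {ι q} {ι p} {ι r} {seq α m} {s k} (0≤ι p) (ι-mono p≤q) qqη≡1 (x≈ m M≤m) near₂

-- Symmetry turns the approximations by pₙ/qₙ and pₙ₋₁/qₙ₋₁ into a chain q α ≈ p and p α ≈ r with a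
-- common p.
palindromic-approximation : ∀ {α a} → ContinuedFraction α a →
  InfinitelyOften (λ n → Palindrome (word a n)) → ∀ N →
  ∃[ q ] ∃[ p ] ∃[ r ] N ℕ.≤ q × 1 ℕ.≤ q × p ℕ.≤ q × IntegerApproximation α q p r
palindromic-approximation {α} {a} cf palindromes N with palindromes N
... | n , N≤n , palindrome = from (continuants (a ∘ suc) n)
  (ℕ.≤-trans N≤n (n≤e₁₁ a>0 n)) (1≤e₁₁ a>0 n) (e₂₁≤e₁₁ a>0 n) (palindrome⇒symmetric a n palindrome)
  -- Taking the tail length `j = K` in `convergent-error` gives an index beyond `K`.
  (λ K → suc (n ℕ.+ K) , ℕ.m≤n⇒m≤1+n (ℕ.m≤n+m K n) , convergent-error {a} a₀≡0 a>0 n K)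
  where
  open ContinuedFraction cf
  a>0 : Positive (a ∘ suc)
  a>0 i = positive (suc i) (ℕ.s≤s ℕ.z≤n)
  -- Stated for an arbitrary matrix, so that the continuants do not unfold inside ι.
  from : ∀ m → N ℕ.≤ e₁₁ m → 1 ℕ.≤ e₁₁ m → e₂₁ m ℕ.≤ e₁₁ m → e₁₂ m ≡ e₂₁ m →
    (∀ K → ∃[ k ] K ℕ.≤ k
      × ℚ.∣ ι (e₁₁ m) ℚ.* convergent a k ℚ.- ι (e₂₁ m) ∣ ℚ.* ι (e₁₁ m) ℚ.≤ 1ℚ
      × ℚ.∣ ι (e₁₂ m) ℚ.* convergent a k ℚ.- ι (e₂₂ m) ∣ ℚ.* ι (e₁₁ m) ℚ.≤ 1ℚ) →
    ∃[ q ] ∃[ p ] ∃[ r ] N ℕ.≤ q × 1 ℕ.≤ q × p ℕ.≤ q × IntegerApproximation α q p r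
  from (matrix q p p r) N≤q 1≤q p≤q refl near =
    q , p , r , N≤q , 1≤q , p≤q , approximation-through-limit {α} limit q p r 1≤q p≤q near

-- Multiplying the quotient's error by `z`, whose terms are eventually at most `B`, calls for
-- precision η = ε/B. The terms of `z` are also bounded away from 0, so `inv` really inverts them.
÷-clear : ∀ {x y z} (z#0 : z # 0ℝ) → x ≈ y ÷ z [ z#0 ] → ∀ {ε} → 0ℚ ℚ.< ε →
  Eventually λ m → ℚ.∣ seq x m ℚ.* seq z m ℚ.- seq y m ∣ ℚ.≤ ε
÷-clear {x} {y} {z} z#0 x≈y/z {ε} ε>0 =
  let (B , B>0 , bounded) = eventually-bounded z
      (δ , δ>0 , away)    = #0⇒bounded-away z z#0
      (η , η>0 , Bη≡ε)    = quotient B>0 ε>0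
  in Eventually-map
       (λ { m (close , z≤B , δ≤z) → clear {B} {δ} {η} (seq x m) (seq y m) (seq z m) δ>0 Bη≡ε close z≤B δ≤z })
       (Eventually-× (x≈y/z η η>0) (Eventually-× bounded away))
  where
  open ℚ.≤-Reasoning
  clear : ∀ {B δ η} p q r → 0ℚ ℚ.< δ → B ℚ.* η ≡ ε → ℚ.∣ p ℚ.- q ℚ.* inv r ∣ ℚ.≤ η →
    ℚ.∣ r ∣ ℚ.≤ B → δ ℚ.≤ ℚ.∣ r ∣ → ℚ.∣ p ℚ.* r ℚ.- q ∣ ℚ.≤ ε
  clear {B} {δ} {η} p q r δ>0 Bη≡ε close r≤B δ≤r = begin
    ℚ.∣ p ℚ.* r ℚ.- q ∣                        ≡⟨ cong (λ s → ℚ.∣ p ℚ.* r ℚ.- s ∣) (ℚ.*-identityʳ q) ⟨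
    ℚ.∣ p ℚ.* r ℚ.- q ℚ.* 1ℚ ∣                 ≡⟨ cong (λ s → ℚ.∣ p ℚ.* r ℚ.- q ℚ.* s ∣) (inv-inverse r r≢0) ⟨
    ℚ.∣ p ℚ.* r ℚ.- q ℚ.* (inv r ℚ.* r) ∣      ≡⟨ cong ℚ.∣_∣ (eq p q r (inv r)) ⟩
    ℚ.∣ r ℚ.* (p ℚ.- q ℚ.* inv r) ∣            ≡⟨ ℚ.∣p*q∣≡∣p∣*∣q∣ r (p ℚ.- q ℚ.* inv r) ⟩
    ℚ.∣ r ∣ ℚ.* ℚ.∣ p ℚ.- q ℚ.* inv r ∣        ≤⟨ *-mono-≤ (ℚ.0≤∣p∣ r) (ℚ.0≤∣p∣ (p ℚ.- q ℚ.* inv r)) r≤B close ⟩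
    B ℚ.* η                                    ≡⟨ Bη≡ε ⟩
    ε                                          ∎
    where
    r≢0 : r ≢ 0ℚ
    r≢0 refl = ℚ.<-irrefl refl (ℚ.<-≤-trans δ>0 δ≤r)
    eq : ∀ p q r i → p ℚ.* r ℚ.- q ℚ.* (i ℚ.* r) ≡ r ℚ.* (p ℚ.- q ℚ.* i)
    eq = solve 4 (λ p q r i → p :* r :- q :* (i :* r) := r :* (p :- q :* i)) refl
      where open +-*-Solver


-- Simultaneous approximation of a number and its homographic image.

-- `Q` is the multiplier and `q` the scale of the errors. The constants are quantified outside, so
-- they are uniform in `N`.
SimultaneousApproximation : ℝ → ℝ → ℚ → ℚ → ℚ → ℕ → Set
SimultaneousApproximation α β S K L N = ∃[ Q ] ∃[ q ] N ℕ.≤ Q × N ℕ.≤ q × ι Q ℚ.≤ S ℚ.* ι q ×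
  Eventually λ m → distℤ (ι Q ℚ.* seq α m) ℚ.* ι q ℚ.≤ K × distℤ (ι Q ℚ.* seq β m) ℚ.* ι q ℚ.≤ L

ℤ⇒ℚ-linear : ∀ i j m n → ℤ⇒ℚ (i ℤ.* + m ℤ.+ j ℤ.* + n) ≡ ℤ⇒ℚ i ℚ.* ι m ℚ.+ ℤ⇒ℚ j ℚ.* ι n
ℤ⇒ℚ-linear i j m n = trans (ℤ⇒ℚ-+ (i ℤ.* + m) (j ℤ.* + n)) (cong₂ ℚ._+_ (ℤ⇒ℚ-* i (+ m)) (ℤ⇒ℚ-* j (+ n)))

distℤ-bound : ∀ Q i {s t q K} x → 0ℚ ℚ.≤ q → ℤ⇒ℚ Q ≡ s → ℤ⇒ℚ i ≡ t →
  ℚ.∣ s ℚ.* x ℚ.- t ∣ ℚ.* q ℚ.≤ K → distℤ (ι ℤ.∣ Q ∣ ℚ.* x) ℚ.* q ℚ.≤ K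
distℤ-bound Q i {q = q} x 0≤q refl refl h = ℚ.≤-trans (*-monoʳ q 0≤q (distℤ-∣∣ Q x i)) h

+-cancelʳ-≤ : ∀ {p q} r → p ℚ.+ r ℚ.≤ q ℚ.+ r → p ℚ.≤ q
+-cancelʳ-≤ {p} {q} r h = subst (ℚ._≤ q) (eq p r) (p≤r+q⇒p-q≤r {p ℚ.+ r} {r} {q} h)
  where
  eq : ∀ p r → p ℚ.+ r ℚ.- r ≡ p
  eq = solve 2 (λ p r → p :+ r :- r := p) refl
    where open +-*-Solver

module HomographyApproximation {α β : ℝ} (a b c d : ℤ) {B δ : ℚ}
  (bounded : Eventually λ m → ℚ.∣ seq β m ∣ ℚ.≤ B) (δ>0 : 0ℚ ℚ.< δ)
  (away : Eventually λ m → δ ℚ.≤ ℚ.∣ ℤ⇒ℚ c ℚ.* seq α m ℚ.+ ℤ⇒ℚ d ∣)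
  (homography : ∀ {η} → 0ℚ ℚ.< η → Eventually λ m →
    ℚ.∣ seq β m ℚ.* (ℤ⇒ℚ c ℚ.* seq α m ℚ.+ ℤ⇒ℚ d) ℚ.- (ℤ⇒ℚ a ℚ.* seq α m ℚ.+ ℤ⇒ℚ b) ∣ ℚ.≤ η)
  where
  open ℚ.≤-Reasoning

  private
    a′ = ℤ⇒ℚ a
    b′ = ℤ⇒ℚ b
    c′ = ℤ⇒ℚ c
    d′ = ℤ⇒ℚ d

  -- `S` comes from |c p + d q| with p ≤ q. `K` weighs two errors of 2/q by |c| and |d|. In `L`, the
  -- 1 is the defect of the homography and the rest bounds |a - c y| times 2. None depends on q.
  S K L : ℚ
  S = ℚ.∣ c′ ∣ ℚ.+ ℚ.∣ d′ ∣
  K = ℚ.∣ c′ ∣ ℚ.* 2ℚ ℚ.+ ℚ.∣ d′ ∣ ℚ.* 2ℚ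
  L = 1ℚ ℚ.+ (ℚ.∣ c′ ∣ ℚ.* B ℚ.+ ℚ.∣ a′ ∣) ℚ.* 2ℚ

  module _ {N M q p r : ℕ} (large : ι N ℚ.+ ℚ.∣ c′ ∣ ℚ.* 2ℚ ℚ.≤ ι M ℚ.* δ)
    (M≤q : M ℕ.≤ q) (1≤q : 1 ℕ.≤ q) (p≤q : p ℕ.≤ q) where

    private
      Q  = c ℤ.* + p ℤ.+ d ℤ.* + q
      Q≡ = ℤ⇒ℚ-linear c d p q

    -- `Q-large` gives |Q| ≥ q δ - 2|c|, and `large` chooses `M` so that this is at least `N` as
    -- soon as q ≥ M.
    N≤∣Q∣ : ∀ x → ℚ.∣ ι q ℚ.* x ℚ.- ι p ∣ ℚ.* ι q ℚ.≤ 2ℚ →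
      δ ℚ.≤ ℚ.∣ c′ ℚ.* x ℚ.+ d′ ∣ → N ℕ.≤ ℤ.∣ Q ∣
    N≤∣Q∣ x qx≈p δ≤cx+d = ι-cancel-≤ (+-cancelʳ-≤ (ℚ.∣ c′ ∣ ℚ.* 2ℚ) (begin
      ι N ℚ.+ ℚ.∣ c′ ∣ ℚ.* 2ℚ          ≤⟨ large ⟩
      ι M ℚ.* δ                        ≤⟨ *-monoʳ δ (ℚ.<⇒≤ δ>0) (ι-mono M≤q) ⟩
      ι q ℚ.* δ                        ≤⟨ Q-large {a′} {b′} {c′} {d′} {x} {0ℚ} {ι q} {ι p} {0ℚ}
                                            (ι-mono 1≤q) qx≈p δ≤cx+d ⟩
      ℚ.∣ c′ ℚ.* ι p ℚ.+ d′ ℚ.* ι q ∣ ℚ.+ ℚ.∣ c′ ∣ ℚ.* 2ℚ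
                                       ≡⟨ cong (λ z → ℚ.∣ z ∣ ℚ.+ ℚ.∣ c′ ∣ ℚ.* 2ℚ) Q≡ ⟨
      ℚ.∣ ℤ⇒ℚ Q ∣ ℚ.+ ℚ.∣ c′ ∣ ℚ.* 2ℚ  ≡⟨ cong (ℚ._+ ℚ.∣ c′ ∣ ℚ.* 2ℚ) (∣ℤ⇒ℚ∣ Q) ⟩
      ι ℤ.∣ Q ∣ ℚ.+ ℚ.∣ c′ ∣ ℚ.* 2ℚ    ∎))
      where open HomographyEstimates

    ∣Q∣≤Sq : ι ℤ.∣ Q ∣ ℚ.≤ S ℚ.* ι q
    ∣Q∣≤Sq = begin
      ι ℤ.∣ Q ∣                        ≡⟨ ∣ℤ⇒ℚ∣ Q ⟨
      ℚ.∣ ℤ⇒ℚ Q ∣                      ≡⟨ cong ℚ.∣_∣ Q≡ ⟩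
      ℚ.∣ c′ ℚ.* ι p ℚ.+ d′ ℚ.* ι q ∣  ≤⟨ ∣up+vq∣≤ c′ d′ (0≤ι p) (ι-mono p≤q) ⟩
      S ℚ.* ι q                        ∎

    Q-simultaneous : ∀ {η} x y → (ι q ℚ.* ι q) ℚ.* η ≡ 1ℚ →
      ℚ.∣ ι q ℚ.* x ℚ.- ι p ∣ ℚ.* ι q ℚ.≤ 2ℚ → ℚ.∣ ι p ℚ.* x ℚ.- ι r ∣ ℚ.* ι q ℚ.≤ 2ℚ →
      ℚ.∣ y ∣ ℚ.≤ B → ℚ.∣ y ℚ.* (c′ ℚ.* x ℚ.+ d′) ℚ.- (a′ ℚ.* x ℚ.+ b′) ∣ ℚ.≤ η →
      distℤ (ι ℤ.∣ Q ∣ ℚ.* x) ℚ.* ι q ℚ.≤ K × distℤ (ι ℤ.∣ Q ∣ ℚ.* y) ℚ.* ι q ℚ.≤ L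
    Q-simultaneous x y qqη≡1 qx≈p px≈r y≤B y≈ =
        distℤ-bound Q (c ℤ.* + r ℤ.+ d ℤ.* + p) x (0≤ι q) Q≡ (ℤ⇒ℚ-linear c d r p)
          (Qx-near-integer px≈r)
      , distℤ-bound Q (a ℤ.* + p ℤ.+ b ℤ.* + q) y (0≤ι q) Q≡ (ℤ⇒ℚ-linear a b p q)
          (Qy-near-integer qqη≡1 y≤B y≈)
      where
      open HomographyEstimates {a′} {b′} {c′} {d′} {x} {y} {ι q} {ι p} {ι r} (ι-mono 1≤q) qx≈p

    approximation-at : N ℕ.≤ q → IntegerApproximation α q p r →
      SimultaneousApproximation α β S K L N
    approximation-at N≤q near =
      let 0<q               = ℚ.<-≤-trans 0<1 (ι-mono 1≤q)
          (η , η>0 , qqη≡1) = quotient (pos*pos 0<q 0<q) 0<1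
          (n , facts)       = Eventually-× near (Eventually-× away
                                (Eventually-× bounded (homography η>0)))
          -- The bound N ≤ |Q| does not mention the index, so a single term of the sequences
          -- suffices for it. The distance bounds below use every later term.
          ((qx≈p , _) , δ≤cx+d , _) = facts n ℕ.≤-refl
      in ℤ.∣ Q ∣ , q , N≤∣Q∣ (seq α n) qx≈p δ≤cx+d , N≤q , ∣Q∣≤Sq , n , λ m n≤m →
      let ((qx≈p , px≈r) , _ , y≤B , y≈) = facts m n≤m
      in Q-simultaneous (seq α m) (seq β m) qqη≡1 qx≈p px≈r y≤B y≈

  approximation : (∀ N → ∃[ q ] ∃[ p ] ∃[ r ] N ℕ.≤ q × 1 ℕ.≤ q × p ℕ.≤ q ×
                         IntegerApproximation α q p r) →
    ∀ N → SimultaneousApproximation α β S K L N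
  approximation near N =
    let (M , large)                         = archimedean (ι N ℚ.+ ℚ.∣ c′ ∣ ℚ.* 2ℚ) δ>0
        -- `M` serves the size of Q and `N` the size of q.
        (q , p , r , M⊔N≤q , 1≤q , p≤q , h) = near (M ℕ.⊔ N)
    in approximation-at {N} {M} {q} {p} {r} large (ℕ.m⊔n≤o⇒m≤o M N M⊔N≤q) 1≤q p≤q
         (ℕ.m⊔n≤o⇒n≤o M N M⊔N≤q) h

simultaneous-approximation : ∀ {α a β} → ContinuedFraction α a →
  InfinitelyOften (λ n → Palindrome (word a n)) → RationalHomography α β →
  ∃[ S ] ∃[ K ] ∃[ L ] 0ℚ ℚ.≤ S × (∀ N → SimultaneousApproximation α β S K L N)
simultaneous-approximation {α} {_} {β} cf palindromes (a , b , c , d , _ , cα+d#0 , β≈) =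
  let (B , _ , bounded)  = eventually-bounded β
      (δ , δ>0 , away)   = #0⇒bounded-away (fromℤ c * α + fromℤ d) cα+d#0
      open HomographyApproximation {α} {β} a b c d bounded δ>0 away
        (÷-clear {β} {fromℤ a * α + fromℤ b} {fromℤ c * α + fromℤ d} cα+d#0 β≈)
  in S , K , L , 0≤p+q (ℚ.0≤∣p∣ (ℤ⇒ℚ c)) (ℚ.0≤∣p∣ (ℤ⇒ℚ d)) ,
     approximation (palindromic-approximation cf palindromes)

-- The infimum and the limit inferior.

-- ι (Q ^ 2) rather than ι Q * ι Q, to match the terms of fromℕ (Q ^ 2).
product-bounds : ∀ {Q S q K L s t} → 0ℚ ℚ.≤ S → 0ℚ ℚ.≤ q → 0ℚ ℚ.≤ s → 0ℚ ℚ.≤ t →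
  ι Q ℚ.≤ S ℚ.* q → s ℚ.* q ℚ.≤ K → t ℚ.* q ℚ.≤ L →
  ι (Q ℕ.^ 2) ℚ.* s ℚ.* t ℚ.≤ (S ℚ.* S) ℚ.* (K ℚ.* L) × ι Q ℚ.* s ℚ.* t ℚ.* q ℚ.≤ S ℚ.* (K ℚ.* L)
product-bounds {Q} {S} {q} {K} {L} {s} {t} 0≤S 0≤q 0≤s 0≤t Q≤Sq sq≤K tq≤L = (begin
  ι (Q ℕ.^ 2) ℚ.* s ℚ.* t                          ≡⟨ cong (λ z → z ℚ.* s ℚ.* t) ιQ²≡ιQ*ιQ ⟩
  ι Q ℚ.* ι Q ℚ.* s ℚ.* t                          ≡⟨ ℚ.*-assoc (ι Q ℚ.* ι Q) s t ⟩
  ι Q ℚ.* ι Q ℚ.* (s ℚ.* t)                        ≤⟨ *-monoʳ (s ℚ.* t) 0≤st (*-mono-≤ (0≤ι Q) (0≤ι Q) Q≤Sq Q≤Sq) ⟩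
  (S ℚ.* q) ℚ.* (S ℚ.* q) ℚ.* (s ℚ.* t)            ≡⟨ eq₁ S q s t ⟩
  (S ℚ.* S) ℚ.* ((s ℚ.* q) ℚ.* (t ℚ.* q))          ≤⟨ *-monoˡ (S ℚ.* S) (0≤p*q 0≤S 0≤S) sqtq≤KL ⟩
  (S ℚ.* S) ℚ.* (K ℚ.* L)                          ∎) , (begin
  ι Q ℚ.* s ℚ.* t ℚ.* q                            ≡⟨ eq₂ (ι Q) q s t ⟩
  ι Q ℚ.* (s ℚ.* t ℚ.* q)                          ≤⟨ *-monoʳ (s ℚ.* t ℚ.* q) (0≤p*q 0≤st 0≤q) Q≤Sq ⟩
  (S ℚ.* q) ℚ.* (s ℚ.* t ℚ.* q)                    ≡⟨ eq₃ S q s t ⟩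
  S ℚ.* ((s ℚ.* q) ℚ.* (t ℚ.* q))                  ≤⟨ *-monoˡ S 0≤S sqtq≤KL ⟩
  S ℚ.* (K ℚ.* L)                                  ∎)
  where
  open ℚ.≤-Reasoning
  ιQ²≡ιQ*ιQ = trans (cong (λ k → ι (Q ℕ.* k)) (ℕ.*-identityʳ Q)) (ι-* Q Q)
  0≤st = 0≤p*q 0≤s 0≤t
  sqtq≤KL = *-mono-≤ (0≤p*q 0≤s 0≤q) (0≤p*q 0≤t 0≤q) sq≤K tq≤L
  eq₁ : ∀ S q s t → (S ℚ.* q) ℚ.* (S ℚ.* q) ℚ.* (s ℚ.* t) ≡ (S ℚ.* S) ℚ.* ((s ℚ.* q) ℚ.* (t ℚ.* q))
  eq₁ = solve 4 (λ S q s t →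
    (S :* q) :* (S :* q) :* (s :* t) := (S :* S) :* ((s :* q) :* (t :* q))) refl
    where open +-*-Solver
  eq₂ : ∀ Q q s t → Q ℚ.* s ℚ.* t ℚ.* q ≡ Q ℚ.* (s ℚ.* t ℚ.* q)
  eq₂ = solve 4 (λ Q q s t → Q :* s :* t :* q := Q :* (s :* t :* q)) refl
    where open +-*-Solver
  eq₃ : ∀ S q s t → (S ℚ.* q) ℚ.* (s ℚ.* t ℚ.* q) ≡ S ℚ.* ((s ℚ.* q) ℚ.* (t ℚ.* q))
  eq₃ = solve 4 (λ S q s t → (S :* q) :* (s :* t :* q) := S :* ((s :* q) :* (t :* q))) refl
    where open +-*-Solver

module _ {α β : ℝ} {S K L : ℚ} (0≤S : 0ℚ ℚ.≤ S)
  (approximation : ∀ N → SimultaneousApproximation α β S K L N) where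

  liminf-finite : liminf (λ q → fromℕ (q ℕ.^ 2) * ‖ fromℕ q * α ‖ * ‖ fromℕ q * β ‖) <+∞
  -- The added 1 is the margin that a strict inequality between reals demands.
  liminf-finite = fromℚ ((S ℚ.* S) ℚ.* (K ℚ.* L) ℚ.+ 1ℚ) , λ N →
    let (Q , q , N≤Q , _ , Q≤Sq , M , close) = approximation N
    in Q , N≤Q , 1ℚ , 0<1 , M , λ m M≤m →
       let (αclose , βclose) = close m M≤m
       in ℚ.+-monoˡ-≤ 1ℚ (proj₁ (product-bounds {Q} 0≤S (0≤ι q)
            (0≤distℤ (ι Q ℚ.* seq α m)) (0≤distℤ (ι Q ℚ.* seq β m)) Q≤Sq αclose βclose))

  -- The product at Q is at most S K L / q, which tends to 0. It is pushed below e/2, and the other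
  -- half of e is the margin for the strict inequality.
  infimum-zero : inf[q≥1] (λ q → fromℕ q * ‖ fromℕ q * α ‖ * ‖ fromℕ q * β ‖) ≡ 0ℝ
  infimum-zero = nonnegative , small
    where
    nonnegative : ∀ q → 1 ℕ.≤ q → 0ℝ ≤ fromℕ q * ‖ fromℕ q * α ‖ * ‖ fromℕ q * β ‖
    nonnegative q _ ε ε>0 = 0 , λ m _ → 0≤p+q
      (0≤p*q (0≤p*q (0≤ι q) (0≤distℤ (ι q ℚ.* seq α m))) (0≤distℤ (ι q ℚ.* seq β m)))
      (ℚ.<⇒≤ ε>0)

    module _ {N Q q : ℕ} {e s t u : ℚ} (0<e : 0ℚ ℚ.< e) (large : S ℚ.* (K ℚ.* L) ℚ.≤ ι N ℚ.* (½ ℚ.* e))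
      (N≤q : N ℕ.≤ q) (1≤q : 1 ℕ.≤ q) (Q≤Sq : ι Q ℚ.≤ S ℚ.* ι q)
      (0≤s : 0ℚ ℚ.≤ s) (0≤t : 0ℚ ℚ.≤ t) (s≤ : s ℚ.* ι q ℚ.≤ K) (t≤ : t ℚ.* ι q ℚ.≤ L) where
      open ℚ.≤-Reasoning

      product≤½e : ι Q ℚ.* s ℚ.* t ℚ.≤ ½ ℚ.* e
      product≤½e = ℚ.*-cancelʳ-≤-pos (ι q) {{ℚ.positive (ℚ.<-≤-trans 0<1 (ι-mono 1≤q))}} (begin
        ι Q ℚ.* s ℚ.* t ℚ.* ι q  ≤⟨ proj₂ (product-bounds {Q} 0≤S (0≤ι q) 0≤s 0≤t Q≤Sq s≤ t≤) ⟩
        S ℚ.* (K ℚ.* L)          ≤⟨ large ⟩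
        ι N ℚ.* (½ ℚ.* e)        ≤⟨ *-monoʳ (½ ℚ.* e) (ℚ.<⇒≤ (pos*pos 0<½ 0<e)) (ι-mono N≤q) ⟩
        ι q ℚ.* (½ ℚ.* e)        ≡⟨ ℚ.*-comm (ι q) (½ ℚ.* e) ⟩
        ½ ℚ.* e ℚ.* ι q          ∎)

      product+½e≤ : 0ℚ ℚ.+ e ℚ.≤ u → ι Q ℚ.* s ℚ.* t ℚ.+ ½ ℚ.* e ℚ.≤ 0ℚ ℚ.+ u
      product+½e≤ e≤u = begin
        ι Q ℚ.* s ℚ.* t ℚ.+ ½ ℚ.* e  ≤⟨ ℚ.+-monoˡ-≤ (½ ℚ.* e) product≤½e ⟩
        ½ ℚ.* e ℚ.+ ½ ℚ.* e          ≡⟨ ½ε+½ε≡ε e ⟩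
        e                            ≡⟨ ℚ.+-identityˡ e ⟨
        0ℚ ℚ.+ e                     ≤⟨ e≤u ⟩
        u                            ≡⟨ ℚ.+-identityˡ u ⟨
        0ℚ ℚ.+ u                     ∎

    small : ∀ ε → 0ℝ < ε →
      ∃[ q ] 1 ℕ.≤ q × fromℕ q * ‖ fromℕ q * α ‖ * ‖ fromℕ q * β ‖ < 0ℝ + ε
    small ε (e , e>0 , k , e≤ε) =
      let (N , large)                                    = archimedean (S ℚ.* (K ℚ.* L)) (pos*pos 0<½ e>0)
          -- The maximum with 1 makes Q an admissible index and q a positive factor that can be
          -- cancelled.
          (Q , q , N⊔1≤Q , N⊔1≤q , Q≤Sq , M , close)     = approximation (N ℕ.⊔ 1)
      in Q , ℕ.m⊔n≤o⇒n≤o N 1 N⊔1≤Q , ½ ℚ.* e , pos*pos 0<½ e>0 , M ℕ.⊔ k , λ m M⊔k≤m →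
      let (αclose , βclose) = close m (ℕ.m⊔n≤o⇒m≤o M k M⊔k≤m)
      in product+½e≤ {N} {Q} {q} {e} {distℤ (ι Q ℚ.* seq α m)} {distℤ (ι Q ℚ.* seq β m)} {seq ε m}
           e>0 large (ℕ.m⊔n≤o⇒m≤o N 1 N⊔1≤q) (ℕ.m⊔n≤o⇒n≤o N 1 N⊔1≤q) Q≤Sq
           (0≤distℤ (ι Q ℚ.* seq α m)) (0≤distℤ (ι Q ℚ.* seq β m)) αclose βclose
           (e≤ε m (ℕ.m⊔n≤o⇒n≤o M k M⊔k≤m))

theorem6 : (α : ℝ) (a : ℕ → ℕ) → ContinuedFraction α a → Bad α →
    InfinitelyOften (λ n → Palindrome (word a n)) →
    (β : ℝ) → RationalHomography α β →
    (inf[q≥1] (λ q → fromℕ q * ‖ fromℕ q * α ‖ * ‖ fromℕ q * β ‖) ≡ 0ℝ) ×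
    (liminf (λ q → fromℕ (q ℕ.^ 2) * ‖ fromℕ q * α ‖ * ‖ fromℕ q * β ‖) <+∞)
theorem6 α a cf _ palindromes β homography =
  let (S , K , L , 0≤S , approximation) =
        simultaneous-approximation {α} {a} {β} cf palindromes homography
  in infimum-zero {α} {β} 0≤S approximation , liminf-finite {α} {β} 0≤S approximation
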